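{- With $p$ running over the primes, $$\lim_{p\to\infty}\frac{|T_p^p|}{p^{p^p}}=\frac1e .$$
   Context: For a prime power $q$ and a natural number $m\ge1$, a map $f:\mathbb{F}_{q^m}\to\mathbb{F}_{q^m}$ is called subfield preserving if $f(\mathbb{F}_q)\subseteq\mathbb{F}_q$ and, for all positive divisors $d,s$ of $m$, $f(\mathbb{F}_{q^d}\setminus\mathbb{F}_{q^s})\subseteq\mathbb{F}_{q^d}\setminus\mathbb{F}_{q^s}$. $T_q^m$ denotes the set of subfield preserving maps $f:\mathbb{F}_{q^m}\to\mathbb{F}_{q^m}$ whose polynomial representation (the unique polynomial of degree less than $q^m$ inducing $f$) has coefficients in $\mathbb{F}_q$. $T_p^p$ is the case $q=m=p$ with $p$ prime. -}

module Defs where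

open import Algebra.Bundles using (CommutativeRing)
import Algebra.Properties.Semiring.Exp as SemiringExp
import Algebra.Properties.Semiring.Sum as SemiringSum
open import Data.Fin.Base using (Fin; toℕ)
open import Data.Integer.Base as ℤ using (+_)
open import Data.Nat.Base as ℕ using (ℕ; zero; suc; _!)
open import Data.Nat.Divisibility using (_∣_)
open import Data.Nat.Primality using (Prime)
import Data.Nat.Properties as ℕ
open import Data.Nat.Solver using () renaming (module +-*-Solver to ℕ-Solver)
open import Data.Product.Base using (Σ; Σ-syntax; ∃; ∃-syntax; _×_; _,_; proj₁; proj₂)
import Data.Rational.Properties as ℚ
import Data.Rational.Unnormalised.Base as ℚᵘ
import Data.Rational.Unnormalised.Properties as ℚᵘ
open import Data.Rational.Solver using (module +-*-Solver)
open import Data.Sum.Base using (inj₁; inj₂)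
open import Data.Vec.Functional using (Vector)
open import Function.Bundles using (Func; Inverse; _⟨$⟩_)
import Function.Relation.Binary.Setoid.Equality as FuncEquality
open import Level using (Level) renaming (suc to lsuc; _⊔_ to _⊔ˡ_)
open import Relation.Binary.Bundles using (Setoid)
import Relation.Binary.Construct.On as On
open import Relation.Binary.PropositionalEquality as ≡
  using (_≡_; refl; sym; trans; cong; cong₂; subst; subst₂)
open import Relation.Unary using (Pred; _∈_; _⊆_; _∖_; _⊢_)


HasCardinality : ∀ {a ℓ} → Setoid a ℓ → ℕ → Set (a ⊔ˡ ℓ)
HasCardinality S n = Inverse S (≡.setoid (Fin n))

record FiniteField (c ℓ : Level) (order : ℕ) : Set (lsuc (c ⊔ˡ ℓ)) where
  field
    commutativeRing : CommutativeRing c ℓ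

  open CommutativeRing commutativeRing public

  field
    0≉1         : 0# ≉ 1#
    inverse     : ∀ x → x ≉ 0# → ∃[ y ] x * y ≈ 1#
    cardinality : HasCardinality setoid order

module _ {c ℓ : Level} {n : ℕ} (F : FiniteField c ℓ n) where

  private module F = FiniteField F
  open F using (Carrier; _≈_; 0#; 1#)
  open SemiringExp F.semiring using (_^_)
  open SemiringSum F.semiring using (sum)

  record IsSubfield (K : Pred Carrier ℓ) : Set (c ⊔ˡ ℓ) where
    field
      resp-≈    : ∀ {x y} → x ≈ y → x ∈ K → y ∈ K
      0#-closed : 0# ∈ K
      1#-closed : 1# ∈ K
      +-closed  : ∀ {x y} → x ∈ K → y ∈ K → x F.+ y ∈ K
      neg-closed : ∀ {x} → x ∈ K → F.- x ∈ K
      *-closed  : ∀ {x y} → x ∈ K → y ∈ K → x F.* y ∈ K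
      inv-closed : ∀ {x y} → x ∈ K → x F.* y ≈ 1# → y ∈ K

  subsetSetoid : ∀ {k} → Pred Carrier k → Setoid (c ⊔ˡ k) ℓ
  subsetSetoid K = On.setoid {B = ∃ K} F.setoid proj₁

  -- A finite field has at most one subfield of each order, so for order r = q ^ d
  -- with d ∣ m this is membership in the subfield 𝔽_{q^d} of 𝔽_{q^m}.
  𝔽 : ℕ → Pred Carrier (c ⊔ˡ lsuc ℓ)
  𝔽 r x = Σ[ K ∈ Pred Carrier ℓ ]
            IsSubfield K × HasCardinality (subsetSetoid K) r × x ∈ K

  Map : Set (c ⊔ˡ ℓ)
  Map = Func F.setoid F.setoid

  evaluate : ∀ {k} → Vector Carrier k → Carrier → Carrier
  evaluate a x = sum (λ i → a i F.* x ^ toℕ i)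

-- For m ≥ 1 all divisors of m are positive.
record SubfieldPreserving {c ℓ} (q m : ℕ) (F : FiniteField c ℓ (q ℕ.^ m))
                          (f : Map F) : Set (c ⊔ˡ lsuc ℓ) where
  field
    base       : 𝔽 F q ⊆ (f ⟨$⟩_) ⊢ 𝔽 F q
    difference : ∀ d s → d ∣ m → s ∣ m →
                 (𝔽 F (q ℕ.^ d) ∖ 𝔽 F (q ℕ.^ s))
                   ⊆ (f ⟨$⟩_) ⊢ (𝔽 F (q ℕ.^ d) ∖ 𝔽 F (q ℕ.^ s))

-- The coefficient vector of length q ^ m is that of the unique polynomial of
-- degree less than q ^ m inducing f.
CoefficientsInBase : ∀ {c ℓ} (q m : ℕ) (F : FiniteField c ℓ (q ℕ.^ m)) →
                     Map F → Set (c ⊔ˡ lsuc ℓ)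
CoefficientsInBase q m F f =
  Σ[ a ∈ Vector Carrier (q ℕ.^ m) ]
    (∀ x → f ⟨$⟩ x ≈ evaluate F a x) × (∀ i → a i ∈ 𝔽 F q)
  where open FiniteField F using (Carrier; _≈_)

-- The maps are compared pointwise; the proofs are ignored.
T : ∀ {c ℓ} (q m : ℕ) → FiniteField c ℓ (q ℕ.^ m) → Setoid (c ⊔ˡ lsuc ℓ) (c ⊔ˡ ℓ)
T q m F = On.setoid
  {B = Σ[ f ∈ Map F ] SubfieldPreserving q m F f × CoefficientsInBase q m F f}
  (FuncEquality.setoid F.setoid F.setoid) proj₁
  where module F = FiniteField F

open import Data.Rational.Base as ℚ
  using (ℚ; 0ℚ; 1ℚ; ½; _+_; _*_; -_; _-_; _≤_; _<_; _⊔_; 1/_; ∣_∣)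

record ℝ : Set where
  field
    seq    : ℕ → ℚ
    cauchy : ∀ ε → 0ℚ < ε → ∃[ N ] ∀ m n → N ℕ.≤ m → N ℕ.≤ n →
             ∣ seq m - seq n ∣ < ε

open ℝ public

private
  twice-* : ∀ a b → (2 ℕ.* b) ℕ.* a ≡ (1 ℕ.* a ℕ.+ 1 ℕ.* a) ℕ.* b
  twice-* = solve 2 (λ a b → (con 2 :* b) :* a := (con 1 :* a :+ con 1 :* a) :* b) refl
    where open ℕ-Solver

  open +-*-Solver using (solve; _:=_; _:+_; _:-_; _:*_; :-_)

  +-half : ∀ ε → ε * ½ + ε * ½ ≡ ε
  +-half ε = trans (sym (ℚ.*-distribˡ-+ ε ½ ½)) (ℚ.*-identityʳ ε)

  half-pos : ∀ {ε} → 0ℚ < ε → 0ℚ < ε * ½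
  half-pos {ε} 0<ε = ℚ.positive⁻¹ _ {{ℚ.pos*pos⇒pos ε {{ℚ.positive 0<ε}} ½}}

  ∣-∣-bound : ∀ {a b} → a ≤ b → - a ≤ b → ∣ a ∣ ≤ b
  ∣-∣-bound {a} a≤b -a≤b with ℚ.∣p∣≡p∨∣p∣≡-p a
  ... | inj₁ eq = subst (_≤ _) (sym eq) a≤b
  ... | inj₂ eq = subst (_≤ _) (sym eq) -a≤b

  p≤∣p∣ : ∀ p → p ≤ ∣ p ∣
  p≤∣p∣ p with ℚ.≤-total 0ℚ p
  ... | inj₁ 0≤p = ℚ.≤-reflexive (sym (ℚ.0≤p⇒∣p∣≡p 0≤p))
  ... | inj₂ p≤0 = ℚ.≤-trans p≤0 (ℚ.0≤∣p∣ p)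

  ∣-∣-swap : ∀ p q → ∣ p - q ∣ ≡ ∣ q - p ∣
  ∣-∣-swap p q = trans (sym (ℚ.∣-p∣≡∣p∣ (p - q)))
    (cong ∣_∣ (solve 2 (λ p q → :- (p :- q) := q :- p) refl p q))

  p≤q+∣p-q∣ : ∀ p q → p ≤ q + ∣ p - q ∣
  p≤q+∣p-q∣ p q = subst (_≤ q + ∣ p - q ∣)
    (solve 2 (λ p q → q :+ (p :- q) := p) refl p q)
    (ℚ.+-monoʳ-≤ q (p≤∣p∣ (p - q)))

  sub-≤ : ∀ {p q r} → p ≤ q + r → p - q ≤ r
  sub-≤ {p} {q} {r} h = subst (p - q ≤_)
    (solve 2 (λ q r → q :+ r :- q := r) refl q r)
    (ℚ.+-monoˡ-≤ (- q) h)

  abs-diff : ∀ {a b c} → a ≤ b + c → b ≤ a + c → ∣ a - b ∣ ≤ c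
  abs-diff {a} {b} {c} h k = ∣-∣-bound (sub-≤ h)
    (subst (_≤ c) (solve 2 (λ a b → b :- a := :- (a :- b)) refl a b) (sub-≤ k))

  abs-nonexp : ∀ p q → ∣ ∣ p ∣ - ∣ q ∣ ∣ ≤ ∣ p - q ∣
  abs-nonexp p q = abs-diff (half p q)
    (subst (λ d → ∣ q ∣ ≤ ∣ p ∣ + d) (∣-∣-swap q p) (half q p))
    where
    half : ∀ p q → ∣ p ∣ ≤ ∣ q ∣ + ∣ p - q ∣
    half p q = subst (λ z → ∣ z ∣ ≤ ∣ q ∣ + ∣ p - q ∣)
      (solve 2 (λ p q → q :+ (p :- q) := p) refl p q)
      (ℚ.∣p+q∣≤∣p∣+∣q∣ q (p - q))

  ⊔-nonexp : ∀ δ a b → ∣ (δ ⊔ a) - (δ ⊔ b) ∣ ≤ ∣ a - b ∣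
  ⊔-nonexp δ a b = abs-diff (half a b)
    (subst (λ d → δ ⊔ b ≤ δ ⊔ a + d) (∣-∣-swap b a) (half b a))
    where
    half : ∀ a b → δ ⊔ a ≤ δ ⊔ b + ∣ a - b ∣
    half a b = ℚ.⊔-lub
      (subst (_≤ δ ⊔ b + ∣ a - b ∣) (ℚ.+-identityʳ δ)
        (ℚ.+-mono-≤ (ℚ.p≤p⊔q δ b) (ℚ.0≤∣p∣ (a - b))))
      (ℚ.≤-trans (p≤q+∣p-q∣ a b) (ℚ.+-monoˡ-≤ ∣ a - b ∣ (ℚ.p≤q⊔p δ b)))

fromℚ : ℚ → ℝ
seq    (fromℚ q) _     = q
cauchy (fromℚ q) ε 0<ε = 0 , λ _ _ _ _ → subst (_< ε) (sym ∣q-q∣≡0) 0<ε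
  where
  ∣q-q∣≡0 : ∣ q - q ∣ ≡ 0ℚ
  ∣q-q∣≡0 = cong ∣_∣ (ℚ.+-inverseʳ q)

0ℝ : ℝ
0ℝ = fromℚ 0ℚ

infixl 6 _-ℝ_
_-ℝ_ : ℝ → ℝ → ℝ
seq    (x -ℝ y) n     = seq x n - seq y n
cauchy (x -ℝ y) ε 0<ε
  with cauchy x (ε * ½) (half-pos 0<ε) | cauchy y (ε * ½) (half-pos 0<ε)
... | M , hx | N , hy = M ℕ.⊔ N , bound
  where
  bound : ∀ m n → M ℕ.⊔ N ℕ.≤ m → M ℕ.⊔ N ℕ.≤ n →
          ∣ (seq x m - seq y m) - (seq x n - seq y n) ∣ < ε
  bound m n l k = ℚ.≤-<-trans
    (subst (λ z → ∣ z ∣ ≤ ∣ seq x m - seq x n ∣ + ∣ seq y m - seq y n ∣)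
      (solve 4 (λ a b c d → (a :- c) :- (b :- d) := (a :- b) :- (c :- d))
        refl (seq x m) (seq y m) (seq x n) (seq y n))
      (ℚ.∣p-q∣≤∣p∣+∣q∣ (seq x m - seq x n) (seq y m - seq y n)))
    (subst (∣ seq x m - seq x n ∣ + ∣ seq y m - seq y n ∣ <_) (+-half ε)
      (ℚ.+-mono-<
        (hx m n (ℕ.m⊔n≤o⇒m≤o M N l) (ℕ.m⊔n≤o⇒m≤o M N k))
        (hy m n (ℕ.m⊔n≤o⇒n≤o M N l) (ℕ.m⊔n≤o⇒n≤o M N k))))

∣_∣ℝ : ℝ → ℝ
seq    ∣ x ∣ℝ n     = ∣ seq x n ∣
cauchy ∣ x ∣ℝ ε 0<ε with cauchy x ε 0<ε
... | N , h = N , λ m n l k → ℚ.≤-<-trans (abs-nonexp (seq x m) (seq x n)) (h m n l k)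

infix 4 _<ℝ_
_<ℝ_ : ℝ → ℝ → Set
x <ℝ y = Σ[ δ ∈ ℚ ] 0ℚ < δ × ∃[ N ] ∀ n → N ℕ.≤ n → seq x n + δ ≤ seq y n

module Reciprocal (δ : ℚ) (0<δ : 0ℚ < δ) where

  pos : ∀ a → ℚ.Positive (δ ⊔ a)
  pos a = ℚ.positive (ℚ.<-≤-trans 0<δ (ℚ.p≤p⊔q δ a))

  recip : ℚ → ℚ
  recip a = (1/ (δ ⊔ a)) {{ℚ.pos⇒nonZero (δ ⊔ a) {{pos a}}}}

  recip-pos : ∀ a → ℚ.Positive (recip a)
  recip-pos a = ℚ.1/pos⇒pos (δ ⊔ a) {{pos a}}

  *-recip : ∀ a → (δ ⊔ a) * recip a ≡ 1ℚ
  *-recip a = ℚ.*-inverseʳ (δ ⊔ a) {{ℚ.pos⇒nonZero (δ ⊔ a) {{pos a}}}}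

  instance
    δ-pos : ℚ.Positive δ
    δ-pos = ℚ.positive 0<δ

  *-recip≤1 : ∀ a → δ * recip a ≤ 1ℚ
  *-recip≤1 a = subst (δ * recip a ≤_) (*-recip a)
    (ℚ.*-monoʳ-≤-nonNeg (recip a)
      {{ℚ.pos⇒nonNeg (recip a) {{recip-pos a}}}} (ℚ.p≤p⊔q δ a))

  recip-diff : ∀ a b →
    (δ * δ) * (recip a - recip b)
      ≡ (δ * recip a) * (δ * recip b) * ((δ ⊔ b) - (δ ⊔ a))
  recip-diff a b = trans
    (cong₂ (λ u v → (δ * δ) * (u - v)) (lem a b) (lem′ a b))
    (solve 5 (λ d u v s t →
        (d :* d) :* (t :* v :* u :- s :* u :* v)
          := (d :* u) :* (d :* v) :* (t :- s))
      refl δ (recip a) (recip b) (δ ⊔ a) (δ ⊔ b))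
    where
    lem : ∀ a b → recip a ≡ (δ ⊔ b) * recip b * recip a
    lem a b = sym (trans (cong (_* recip a) (*-recip b)) (ℚ.*-identityˡ (recip a)))

    lem′ : ∀ a b → recip b ≡ (δ ⊔ a) * recip a * recip b
    lem′ a b = lem b a

  nonNeg-δ* : ∀ a → ℚ.NonNegative (δ * recip a)
  nonNeg-δ* a = ℚ.pos⇒nonNeg (δ * recip a) {{ℚ.pos*pos⇒pos δ (recip a) {{recip-pos a}}}}

  recip-close : ∀ a b → (δ * δ) * ∣ recip a - recip b ∣ ≤ ∣ a - b ∣
  recip-close a b = subst (_≤ ∣ a - b ∣) (sym eq)
    (ℚ.≤-trans
      (ℚ.*-monoʳ-≤-nonNeg D {{ℚ.∣-∣-nonNeg ((δ ⊔ b) - (δ ⊔ a))}} uv≤1)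
      (ℚ.≤-trans (ℚ.≤-reflexive (ℚ.*-identityˡ D))
        (ℚ.≤-trans (⊔-nonexp δ b a) (ℚ.≤-reflexive (∣-∣-swap b a)))))
    where
    D u v : ℚ
    D = ∣ (δ ⊔ b) - (δ ⊔ a) ∣
    u = δ * recip a
    v = δ * recip b

    uv≤1 : u * v ≤ 1ℚ
    uv≤1 = ℚ.≤-trans
      (ℚ.*-monoʳ-≤-nonNeg v {{nonNeg-δ* b}} (*-recip≤1 a))
      (ℚ.≤-trans (ℚ.≤-reflexive (ℚ.*-identityˡ v)) (*-recip≤1 b))

    nonNeg-uv : ℚ.NonNegative (u * v)
    nonNeg-uv = ℚ.nonNeg*nonNeg⇒nonNeg u {{nonNeg-δ* a}} v {{nonNeg-δ* b}}

    nonNeg-δδ : ℚ.NonNegative (δ * δ)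
    nonNeg-δδ = ℚ.pos⇒nonNeg (δ * δ) {{ℚ.pos*pos⇒pos δ δ}}

    eq : (δ * δ) * ∣ recip a - recip b ∣ ≡ (u * v) * D
    eq = trans (cong (_* ∣ recip a - recip b ∣)
                 (sym (ℚ.0≤p⇒∣p∣≡p (ℚ.nonNegative⁻¹ (δ * δ) {{nonNeg-δδ}}))))
        (trans (sym (ℚ.∣p*q∣≡∣p∣*∣q∣ (δ * δ) (recip a - recip b)))
        (trans (cong ∣_∣ (recip-diff a b))
        (trans (ℚ.∣p*q∣≡∣p∣*∣q∣ (u * v) ((δ ⊔ b) - (δ ⊔ a)))
               (cong (_* D) (ℚ.0≤p⇒∣p∣≡p (ℚ.nonNegative⁻¹ (u * v) {{nonNeg-uv}}))))))

-- If x is eventually at least δ > 0, then δ ⊔ seq x n is eventually seq x n.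
reciprocal : (x : ℝ) → 0ℝ <ℝ x → ℝ
seq    (reciprocal x (δ , 0<δ , _)) n     = Reciprocal.recip δ 0<δ (seq x n)
cauchy (reciprocal x (δ , 0<δ , _)) ε 0<ε
  with cauchy x (δ * δ * ε) (ℚ.positive⁻¹ _
    {{ℚ.pos*pos⇒pos (δ * δ) {{ℚ.pos*pos⇒pos δ {{ℚ.positive 0<δ}} δ {{ℚ.positive 0<δ}}}}
                    ε {{ℚ.positive 0<ε}}}})
... | N , h = N , λ m n l k →
  ℚ.*-cancelˡ-<-nonNeg (δ * δ)
    {{ℚ.pos⇒nonNeg (δ * δ) {{ℚ.pos*pos⇒pos δ {{ℚ.positive 0<δ}} δ {{ℚ.positive 0<δ}}}}}}
    (ℚ.≤-<-trans (Reciprocal.recip-close δ 0<δ (seq x m) (seq x n)) (h m n l k))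

invFact : ℕ → ℚ
invFact k = (+ 1 ℚ./ (k !)) {{k ℕ.!≢0}}

expPartialSum : ℕ → ℚ
expPartialSum zero    = 0ℚ
expPartialSum (suc n) = expPartialSum n + invFact n

private
  toℚᵘ-/ : ∀ k d → ℚ.toℚᵘ ((+ k) ℚ./ suc d) ℚᵘ.≃ ℚᵘ.mkℚᵘ (+ k) d
  toℚᵘ-/ k d = ℚ.toℚᵘ-fromℚᵘ (ℚᵘ.mkℚᵘ (+ k) d)

  1/+1/≤1/ : ∀ a b .{{_ : ℕ.NonZero a}} .{{_ : ℕ.NonZero b}} → 2 ℕ.* b ℕ.≤ a →
             (+ 1) ℚ./ a + (+ 1) ℚ./ a ≤ (+ 1) ℚ./ b
  1/+1/≤1/ (suc a) (suc b) 2b≤a = ℚ.toℚᵘ-cancel-≤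
    (ℚᵘ.≤-respʳ-≃ (ℚᵘ.≃-sym (toℚᵘ-/ 1 b))
      (ℚᵘ.≤-respˡ-≃ (ℚᵘ.≃-sym (ℚᵘ.≃-trans (ℚ.toℚᵘ-homo-+ 1/a 1/a)
                                (ℚᵘ.+-cong (toℚᵘ-/ 1 a) (toℚᵘ-/ 1 a))))
        (ℚᵘ.*≤* (ℤ.+≤+ bound))))
    where
    1/a : ℚ
    1/a = (+ 1) ℚ./ suc a

    bound : (1 ℕ.* suc a ℕ.+ 1 ℕ.* suc a) ℕ.* suc b ℕ.≤ 1 ℕ.* (suc a ℕ.* suc a)
    bound = subst₂ ℕ._≤_
      (twice-* (suc a) (suc b))
      (sym (ℕ.*-identityˡ (suc a ℕ.* suc a)))
      (ℕ.*-monoˡ-≤ (suc a) 2b≤a)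

  n≤n! : ∀ n → n ℕ.≤ n !
  n≤n! zero    = ℕ.z≤n
  n≤n! (suc n) = ℕ.m≤m*n (suc n) (n !) {{n ℕ.!≢0}}

  archimedean : ∀ ε → 0ℚ < ε → ∃[ d ] (+ 1) ℚ./ suc d < ε
  archimedean (ℚ.mkℚ (+ 0) _ _) (ℚ.*<* (ℤ.+<+ ()))
  archimedean (ℚ.mkℚ (ℤ.-[1+ _ ]) _ _) (ℚ.*<* ())
  archimedean (ℚ.mkℚ (+ suc k) d _) _ = suc d , ℚ.toℚᵘ-cancel-<
    (ℚᵘ.<-respˡ-≃ (ℚᵘ.≃-sym (toℚᵘ-/ 1 (suc d))) (ℚᵘ.*<* (ℤ.+<+ bound)))
    where
    bound : 1 ℕ.* suc d ℕ.< suc k ℕ.* suc (suc d)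
    bound = subst (ℕ._< suc k ℕ.* suc (suc d)) (sym (ℕ.*-identityˡ (suc d)))
      (ℕ.<-≤-trans (ℕ.n<1+n (suc d)) (ℕ.m≤n*m (suc (suc d)) (suc k)))

  0≤invFact : ∀ n → 0ℚ ≤ invFact n
  0≤invFact n = ℚ.nonNegative⁻¹ _ {{ℚ.normalize-nonNeg 1 (n !) {{n ℕ.!≢0}}}}

  S W : ℕ → ℚ
  S = expPartialSum
  W n = S n + (invFact n + invFact n)

  ≤-+ : ∀ p {q} → 0ℚ ≤ q → p ≤ p + q
  ≤-+ p {q} 0≤q = subst (_≤ p + q) (ℚ.+-identityʳ p) (ℚ.+-monoʳ-≤ p 0≤q)

  S-mono : ∀ {m n} → m ℕ.≤′ n → S m ≤ S n
  S-mono ℕ.≤′-refl = ℚ.≤-refl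
  S-mono (ℕ.≤′-step {n = n} l) = ℚ.≤-trans (S-mono l) (≤-+ (S n) (0≤invFact n))

  S≤W : ∀ n → S n ≤ W n
  S≤W n = ≤-+ (S n) (ℚ.≤-trans (0≤invFact n) (≤-+ (invFact n) (0≤invFact n)))

  W-step : ∀ n → W (suc (suc n)) ≤ W (suc n)
  W-step n = ℚ.≤-trans
    (ℚ.+-monoʳ-≤ (S (suc (suc n)))
      (1/+1/≤1/ (suc (suc n) !) (suc n !) {{suc (suc n) ℕ.!≢0}} {{suc n ℕ.!≢0}}
        (ℕ.*-monoˡ-≤ (suc n !) {2} {suc (suc n)} (ℕ.s≤s (ℕ.s≤s ℕ.z≤n)))))
    (ℚ.≤-reflexive (ℚ.+-assoc (S (suc n)) (invFact (suc n)) (invFact (suc n))))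

  W-anti : ∀ {m n} → suc m ℕ.≤′ n → W n ≤ W (suc m)
  W-anti ℕ.≤′-refl                = ℚ.≤-refl
  W-anti {n = suc (suc n)} (ℕ.≤′-step l) = ℚ.≤-trans (W-step n) (W-anti l)
  W-anti {n = suc zero} (ℕ.≤′-step (ℕ.≤′-reflexive ()))

e : ℝ
seq    e = expPartialSum
cauchy e ε 0<ε with archimedean ε 0<ε
... | d , 1/d<ε = N , λ m n l k → ℚ.≤-<-trans (close m n l k) tail<ε
  where
  N : ℕ
  N = 2 ℕ.* suc d

  tail : ℚ
  tail = invFact N + invFact N

  tail<ε : tail < ε
  tail<ε = ℚ.≤-<-trans (1/+1/≤1/ (N !) (suc d) {{N ℕ.!≢0}} (n≤n! N)) 1/d<ε

  half : ∀ m n → N ℕ.≤ m → N ℕ.≤ n → S m ≤ S n + tail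
  half m n l k = ℚ.≤-trans (S≤W m)
    (ℚ.≤-trans (W-anti (ℕ.≤⇒≤′ l)) (ℚ.+-monoˡ-≤ tail (S-mono (ℕ.≤⇒≤′ k))))

  close : ∀ m n → N ℕ.≤ m → N ℕ.≤ n → ∣ S m - S n ∣ ≤ tail
  close m n l k = abs-diff (half m n l k) (half n m k l)

0<e : 0ℝ <ℝ e
0<e = 1ℚ , ℚ.positive⁻¹ 1ℚ , 1 , λ n 1≤n → S-mono (ℕ.≤⇒≤′ 1≤n)

LimitOverPrimes : (∀ p → Prime p → ℝ) → ℝ → Set
LimitOverPrimes a L =
  ∀ ε → 0ℝ <ℝ ε → ∃[ N ] ∀ p (pr : Prime p) → N ℕ.≤ p → ∣ a p pr -ℝ L ∣ℝ <ℝ ε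

{-# OPTIONS --safe #-}
module Submission where

-- The coefficients of a map f of 𝔽_{p^p} are given by an interpolation formula, so they
-- lie in 𝔽_p iff f commutes with the Frobenius map φ x = xᵖ, whose fixed points are 𝔽_p.
-- Since the divisors of p are 1 and p, the elements of T are thus the maps commuting
-- with φ that send non-fixed points to non-fixed points. On the non-fixed points φ has
-- M = pᵖ⁻¹ − 1 orbits, all of size p, and f is determined by its values on 𝔽_p, arbitrary
-- in 𝔽_p, and on one point of each orbit, arbitrary among the non-fixed points. Hence
-- |T| = pᵖ (M p)ᴹ and, as pᵖ = (M + 1) p, |T| / p^(p^p) = (1 − t)ᴹ for t = 1/(M + 1).
-- Mean value bounds for the partial sums of the exponential series give
-- (1 − t)ᴹ⁺¹ e ≤ 1 ≤ (1 − t)ᴹ e, so (1 − t)ᴹ differs from 1/e by at most t.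

open import Defs
open import Algebra.Bundles using (CommutativeMonoid; module CommutativeRing)
import Algebra.Properties.CommutativeMonoid.Sum as MonoidSum
import Algebra.Properties.CommutativeSemiring.Binomial as Binomial
import Algebra.Properties.CommutativeSemiring.Exp as SemiringExp
import Algebra.Properties.Ring as RingProperties
import Algebra.Properties.Semiring.Mult as SemiringMult
import Algebra.Properties.Semiring.Sum as SemiringSum
import Algebra.Solver.Ring.NaturalCoefficients.Default as SemiringSolver
open import Data.Fin.Base using (Fin; zero; suc; toℕ; fromℕ; fromℕ<; inject₁; punchIn; punchOut; combine; remQuot; funToFin; finToFun)
open import Data.Fin.Permutation using (Permutation; permutation; ↔⇒≡)
import Data.Fin.Properties as Fin
open import Data.Nat.Base as ℕ using (ℕ; zero; suc; NonZero; _!; s≤s; z≤n)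
open import Data.Nat.Combinatorics using (_C_; nCk≡n!/k![n-k]!; k![n∸k]!∣n!; nCn≡1)
open import Data.Nat.Coprimality using (prime⇒coprime; coprime-Bézout)
open import Data.Nat.Divisibility using (_∣_; divides; 1∣_; ∣-refl; ∣⇒≤; m∣m*n)
open import Data.Nat.DivMod using (m/n*n≡m; m≡m%n+[m/n]*n; m%n<n)
open import Data.Nat.GCD using (module Bézout)
open import Data.Nat.Primality using (Prime; prime⇒nonZero; prime⇒nonTrivial; prime⇒irreducible; euclidsLemma)
import Data.Nat.Properties as ℕ
open import Data.Nat.Solver using () renaming (module +-*-Solver to ℕ-Solver)
open import Data.Product.Base using (Σ-syntax; ∃-syntax; _×_; _,_; proj₁; proj₂; uncurry)
open import Data.Sum.Base using (_⊎_; inj₁; inj₂; [_,_]′)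
open import Data.Sum.Function.Propositional using (_⊎-↔_)
open import Data.Vec.Functional using (Vector)
open import Function.Base using (_∘_; const)
open import Function.Bundles using (Inverse; Func; _⟨$⟩_; mk↔ₛ′)
open import Function.Properties.Inverse using (↔-refl; ↔-sym; ↔-trans)
open import Level using (_⊔_)
open import Relation.Binary.Definitions using (tri<; tri≈; tri>)
open import Relation.Binary.PropositionalEquality as ≡ using (_≡_; _≢_)
import Relation.Binary.Reasoning.Setoid as SetoidReasoning
open import Relation.Nullary using (¬_; Dec; yes; no; contradiction)
open import Relation.Nullary.Decidable using (map′; ¬?; _×-dec_)
open import Relation.Unary using (Pred; Decidable)

-- Finite fields

-- Membership in `𝔽 F p` quantifies over all subfields with p elements, so it becomes usable only
-- once identified with `Fixed`. This needs both that φ has exactly the fixed points 0, 1, ..., p -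
-- 1 and that these exhaust every subfield of order p. The interpolation formula comes from G(x, y)
-- = (xⁿ - yⁿ)/(x - y), with n the order of the field: G is 1 for x ≠ y and 0 for x = y. The
-- resulting coefficients are, up to sign and a correction of the constant term, power sums Σ f(y)
-- yᵏ, whose summands are permuted by φ when f commutes with φ. M is never computed: the orbit count
-- pᵖ = (M + 1) p gives all that is used, including p ≤ M + 1, which drives t to 0. Reals are Cauchy
-- sequences of rationals, so exp itself never occurs. Every inequality for e is proved for partial
-- sums, and a lower bound for such a sum requires enough terms.

module SumUpdate {c ℓ} (M : CommutativeMonoid c ℓ) where

  open CommutativeMonoid M
  open MonoidSum M

  -- A monoid has no subtraction, so the term at j is replaced by the neutral element rather than
  -- removed. The monoid is multiplicative in `x^order≈x` and additive in `evaluate-coefficients`.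
  sum-update : ∀ {n} (t u : Vector Carrier n) j → u j ≈ ε →
               (∀ i → i ≢ j → u i ≈ t i) → t j ∙ sum u ≈ sum t
  sum-update {suc n} t u j uj≈ε u≈t = begin
    t j ∙ sum u                                     ≈⟨ ∙-congˡ (sum-remove {i = j} u) ⟩
    t j ∙ (u j ∙ sum (u ∘ punchIn j))               ≈⟨ ∙-congˡ (∙-congʳ uj≈ε) ⟩
    t j ∙ (ε ∙ sum (u ∘ punchIn j))                 ≈⟨ ∙-congˡ (identityˡ _) ⟩
    t j ∙ sum (u ∘ punchIn j)                       ≈⟨ ∙-congˡ (sum-cong-≋ (λ i → u≈t _ (Fin.punchInᵢ≢i j i))) ⟩
    t j ∙ sum (t ∘ punchIn j)                       ≈⟨ sum-remove {i = j} t ⟨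
    sum t                                           ∎
    where open SetoidReasoning setoid

module FieldProperties {c ℓ n} (F : FiniteField c ℓ n) where

  open FiniteField F public renaming (zero to *-zero)
  open SemiringExp commutativeSemiring public
  open SemiringMult semiring public using (×1-homo-*; ×-assoc-*; ×-homo-+; ×-congˡ; ×-congʳ)
    renaming (_×_ to _×ᶠ_)
  open SemiringSum semiring public
  open RingProperties ring public using (+-cancelˡ; +-cancelʳ)
  open SemiringSolver commutativeSemiring public using (solve; _:=_; _:+_; _:*_)
  open SetoidReasoning setoid public
  private module Π = MonoidSum *-commutativeMonoid

  module Enum = Inverse cardinality
  index = Enum.to
  elem = Enum.from

  elem-index : ∀ x → elem (index x) ≈ x
  elem-index = Enum.strictlyInverseʳ

  index-elem : ∀ i → index (elem i) ≡ i
  index-elem = Enum.strictlyInverseˡ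

  index-injective : ∀ {x y} → index x ≡ index y → x ≈ y
  index-injective {x} {y} eq = begin
    x              ≈⟨ elem-index x ⟨
    elem (index x) ≡⟨ ≡.cong elem eq ⟩
    elem (index y) ≈⟨ elem-index y ⟩
    y              ∎

  infix 4 _≟_
  _≟_ : ∀ x y → Dec (x ≈ y)
  x ≟ y = map′ index-injective Enum.to-cong (index x Fin.≟ index y)

  *-cancelˡ : ∀ {x y z} → x ≉ 0# → x * y ≈ x * z → y ≈ z
  *-cancelˡ {x} {y} {z} x≉0 xy≈xz with x⁻¹ , xx⁻¹≈1 ← inverse x x≉0 = begin
    y              ≈⟨ lem y ⟩
    x⁻¹ * (x * y)  ≈⟨ *-congˡ xy≈xz ⟩
    x⁻¹ * (x * z)  ≈⟨ lem z ⟨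
    z              ∎
    where
    lem : ∀ y → y ≈ x⁻¹ * (x * y)
    lem y = begin
      y              ≈⟨ *-identityˡ y ⟨
      1# * y         ≈⟨ *-congʳ (trans (sym xx⁻¹≈1) (*-comm x x⁻¹)) ⟩
      x⁻¹ * x * y    ≈⟨ *-assoc x⁻¹ x y ⟩
      x⁻¹ * (x * y)  ∎

  -- (x − r)(u − v) = 0 with the negative terms moved to the other side.
  cross-cancel : ∀ {x r u v} → x * u + r * v ≈ x * v + r * u → x ≈ r ⊎ u ≈ v
  cross-cancel {x} {r} {u} {v} eq with x ≟ r
  ... | yes x≈r = inj₁ x≈r
  ... | no x≉r = inj₂ (*-cancelˡ d≉0 (+-cancelʳ (r * (u + v)) _ _ (begin
    d * u + r * (u + v)           ≈⟨ solve 4 (λ d r u v → d :* u :+ r :* (u :+ v) := (d :+ r) :* u :+ r :* v) refl d r u v ⟩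
    (d + r) * u + r * v           ≈⟨ +-congʳ (*-congʳ d+r≈x) ⟩
    x * u + r * v                 ≈⟨ eq ⟩
    x * v + r * u                 ≈⟨ +-congʳ (*-congʳ d+r≈x) ⟨
    (d + r) * v + r * u           ≈⟨ solve 4 (λ d r u v → (d :+ r) :* v :+ r :* u := d :* v :+ r :* (u :+ v)) refl d r u v ⟩
    d * v + r * (u + v)           ∎)))
    where
    d = x + - r
    d+r≈x : d + r ≈ x
    d+r≈x = begin
      x + - r + r   ≈⟨ +-assoc x (- r) r ⟩
      x + (- r + r) ≈⟨ +-congˡ (-‿inverseˡ r) ⟩
      x + 0#        ≈⟨ +-identityʳ x ⟩
      x             ∎
    d≉0 : d ≉ 0#
    d≉0 d≈0 = x≉r (begin
      x      ≈⟨ d+r≈x ⟨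
      d + r  ≈⟨ +-congʳ d≈0 ⟩
      0# + r ≈⟨ +-identityˡ r ⟩
      r      ∎)

  *-≉0 : ∀ {x y} → x ≉ 0# → y ≉ 0# → x * y ≉ 0#
  *-≉0 {x} x≉0 y≉0 xy≈0 = y≉0 (*-cancelˡ x≉0 (trans xy≈0 (sym (zeroʳ x))))

  ^-≉0 : ∀ {x} m → x ≉ 0# → x ^ m ≉ 0#
  ^-≉0 zero    x≉0 = 0≉1 ∘ sym
  ^-≉0 (suc m) x≉0 = *-≉0 x≉0 (^-≉0 m x≉0)

  Π-≉0 : ∀ {m} (t : Vector Carrier m) → (∀ i → t i ≉ 0#) → Π.sum t ≉ 0#
  Π-≉0 {zero}  t t≉0 = 0≉1 ∘ sym
  Π-≉0 {suc m} t t≉0 = *-≉0 (t≉0 zero) (Π-≉0 (t ∘ suc) (t≉0 ∘ suc))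

  -- Applied to y ↦ 1 + y, to y ↦ x y and to the Frobenius map.
  module Bijection (φ ψ : Carrier → Carrier)
    (φ-cong : ∀ {x y} → x ≈ y → φ x ≈ φ y) (ψ-cong : ∀ {x y} → x ≈ y → ψ x ≈ ψ y)
    (φψ : ∀ x → φ (ψ x) ≈ x) (ψφ : ∀ x → ψ (φ x) ≈ x) where

    π : Permutation n n
    π = permutation (index ∘ φ ∘ elem) (index ∘ ψ ∘ elem)
      (λ i → ≡.trans (Enum.to-cong (trans (φ-cong (elem-index _)) (φψ _))) (index-elem i))
      (λ i → ≡.trans (Enum.to-cong (trans (ψ-cong (elem-index _)) (ψφ _))) (index-elem i))

    sum-reindex : ∀ {g : Carrier → Carrier} → (∀ {x y} → x ≈ y → g x ≈ g y) →
                  sum (g ∘ elem) ≈ sum (g ∘ φ ∘ elem)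
    sum-reindex {g} g-cong = trans (sum-permute (g ∘ elem) π)
      (sum-cong-≋ (λ i → g-cong (elem-index (φ (elem i)))))

    Π-reindex : ∀ {g : Carrier → Carrier} → (∀ {x y} → x ≈ y → g x ≈ g y) →
                Π.sum (g ∘ elem) ≈ Π.sum (g ∘ φ ∘ elem)
    Π-reindex {g} g-cong = trans (Π.sum-permute (g ∘ elem) π)
      (Π.sum-cong-≋ (λ i → g-cong (elem-index (φ (elem i)))))

  -- Compare Σ y over the field with its translate Σ (1 + y).
  order×1≈0 : n ×ᶠ 1# ≈ 0#
  order×1≈0 = +-cancelʳ (sum elem) _ _ (begin
    n ×ᶠ 1# + sum elem                 ≈⟨ +-congʳ (sum-replicate n) ⟨
    sum {n} (const 1#) + sum elem      ≈⟨ ∑-distrib-+ (const 1#) elem ⟨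
    sum (λ i → 1# + elem i)            ≈⟨ B.sum-reindex (λ eq → eq) ⟨
    sum elem                           ≈⟨ +-identityˡ _ ⟨
    0# + sum elem                      ∎)
    where
    cancel : ∀ a b → a + b ≈ 0# → ∀ x → a + (b + x) ≈ x
    cancel a b a+b≈0 x = begin
      a + (b + x) ≈⟨ +-assoc a b x ⟨
      a + b + x   ≈⟨ +-congʳ a+b≈0 ⟩
      0# + x      ≈⟨ +-identityˡ x ⟩
      x           ∎
    module B = Bijection (1# +_) (- 1# +_) +-congˡ +-congˡ
      (cancel _ _ (-‿inverseʳ 1#)) (cancel _ _ (-‿inverseˡ 1#))

  private
    -- g replaces 0 by 1 and h x replaces everything else by x, so that
    -- g (x y) = h x y · g y holds for all y.
    g : Carrier → Carrier
    g y with y ≟ 0#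
    ... | yes _ = 1#
    ... | no  _ = y

    h : Carrier → Carrier → Carrier
    h x y with y ≟ 0#
    ... | yes _ = 1#
    ... | no  _ = x

    g-cong : ∀ {x y} → x ≈ y → g x ≈ g y
    g-cong {x} {y} x≈y with x ≟ 0# | y ≟ 0#
    ... | yes _   | yes _   = refl
    ... | yes x≈0 | no  y≉0 = contradiction (trans (sym x≈y) x≈0) y≉0
    ... | no  x≉0 | yes y≈0 = contradiction (trans x≈y y≈0) x≉0
    ... | no  _   | no  _   = x≈y

    g≉0 : ∀ y → g y ≉ 0#
    g≉0 y with y ≟ 0#
    ... | yes _  = 0≉1 ∘ sym
    ... | no y≉0 = y≉0

    g-* : ∀ {x} → x ≉ 0# → ∀ y → g (x * y) ≈ h x y * g y
    g-* {x} x≉0 y with y ≟ 0# | x * y ≟ 0#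
    ... | yes _   | yes _    = sym (*-identityˡ 1#)
    ... | yes y≈0 | no xy≉0  = contradiction (trans (*-congˡ y≈0) (zeroʳ x)) xy≉0
    ... | no  y≉0 | yes xy≈0 = contradiction xy≈0 (*-≉0 x≉0 y≉0)
    ... | no  _   | no  _    = refl

    h-0 : ∀ {x y} → y ≈ 0# → h x y ≈ 1#
    h-0 {x} {y} y≈0 with y ≟ 0#
    ... | yes _  = refl
    ... | no y≉0 = contradiction y≈0 y≉0

    h-≉0 : ∀ {x y} → y ≉ 0# → h x y ≈ x
    h-≉0 {x} {y} y≉0 with y ≟ 0#
    ... | yes y≈0 = contradiction y≈0 y≉0
    ... | no  _   = refl

  -- For x ≠ 0 multiplication by x permutes the field. Comparing the product G of the nonzero
  -- elements with its image gives Π h x = 1, and this product has a factor x everywhere except at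
  -- 0, so one more x makes it xⁿ.
  x^order≈x : ∀ x → x ^ n ≈ x
  x^order≈x x with x ≟ 0#
  ... | yes x≈0 = trans (^-congˡ n x≈0) (trans (0^order (index x)) (sym x≈0))
    where
    -- Since 0⁰ = 1, the order has to be positive; `index x` inhabits `Fin n`.
    0^order : ∀ {m} → Fin m → 0# ^ m ≈ 0#
    0^order {suc m} _ = zeroˡ (0# ^ m)
  ... | no x≉0 with x⁻¹ , xx⁻¹≈1 ← inverse x x≉0 = begin
    x ^ n                        ≈⟨ Π.sum-replicate n ⟨
    Π.sum {n} (const x)          ≈⟨ SumUpdate.sum-update *-commutativeMonoid (const x) (h x ∘ elem) (index 0#)
                                      (h-0 (elem-index 0#)) (λ i i≢0 → h-≉0 (λ ei≈0 → i≢0 (≡.trans (≡.sym (index-elem i)) (Enum.to-cong ei≈0)))) ⟨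
    x * Π.sum (h x ∘ elem)       ≈⟨ *-congˡ (*-cancelˡ (Π-≉0 (g ∘ elem) (g≉0 ∘ elem)) (begin
      G * Π.sum (h x ∘ elem)           ≈⟨ *-comm _ _ ⟩
      Π.sum (h x ∘ elem) * G           ≈⟨ Π.∑-distrib-+ (h x ∘ elem) (g ∘ elem) ⟨
      Π.sum (λ i → h x (elem i) * g (elem i))  ≈⟨ Π.sum-cong-≋ (λ i → g-* x≉0 (elem i)) ⟨
      Π.sum (λ i → g (x * elem i))     ≈⟨ B.Π-reindex g-cong ⟨
      G                                ≈⟨ *-identityʳ G ⟨
      G * 1#                           ∎)) ⟩
    x * 1#                       ≈⟨ *-identityʳ x ⟩
    x                            ∎
    where
    G = Π.sum (g ∘ elem)
    cancel : ∀ a b → a * b ≈ 1# → ∀ y → a * (b * y) ≈ y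
    cancel a b ab≈1 y = begin
      a * (b * y) ≈⟨ *-assoc a b y ⟨
      a * b * y   ≈⟨ *-congʳ ab≈1 ⟩
      1# * y      ≈⟨ *-identityˡ y ⟩
      y           ∎
    module B = Bijection (x *_) (x⁻¹ *_) *-congˡ *-congˡ
      (cancel _ _ xx⁻¹≈1) (cancel _ _ (trans (*-comm x⁻¹ x) xx⁻¹≈1))

  -- The quotient (xᵐ - yᵐ)/(x - y), written as a sum so that it also makes sense for x = y.
  geometric : ℕ → Carrier → Carrier → Carrier
  geometric m x y = ∑[ i < m ] (x ^ toℕ i * y ^ (m ℕ.∸ suc (toℕ i)))

  geometric-suc : ∀ m x y → geometric (suc m) x y ≈ y ^ m + x * geometric m x y
  geometric-suc m x y = +-cong (*-identityˡ (y ^ m)) (begin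
    ∑[ i < m ] (x * x ^ toℕ i * y ^ (m ℕ.∸ suc (toℕ i)))   ≈⟨ sum-cong-≋ {m} (λ i → *-assoc x (x ^ toℕ i) _) ⟩
    ∑[ i < m ] (x * (x ^ toℕ i * y ^ (m ℕ.∸ suc (toℕ i)))) ≈⟨ *-distribˡ-sum {m} x _ ⟨
    x * geometric m x y                                    ∎)

  -- (x − y) Σ xⁱ yʲ = xᵐ − yᵐ, with the negative terms moved to the other side.
  geometric-identity : ∀ m x y → x ^ m + y * geometric m x y ≈ y ^ m + x * geometric m x y
  geometric-identity zero    x y = +-congˡ (trans (zeroʳ y) (sym (zeroʳ x)))
  geometric-identity (suc m) x y = begin
    x * x ^ m + y * geometric (suc m) x y        ≈⟨ +-congˡ (*-congˡ (geometric-suc m x y)) ⟩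
    x * x ^ m + y * (y ^ m + x * G)              ≈⟨ solve 5 (λ x y X Y G → x :* X :+ y :* (Y :+ x :* G) := y :* Y :+ x :* (X :+ y :* G)) refl x y (x ^ m) (y ^ m) G ⟩
    y * y ^ m + x * (x ^ m + y * G)              ≈⟨ +-congˡ (*-congˡ (geometric-identity m x y)) ⟩
    y * y ^ m + x * (y ^ m + x * G)              ≈⟨ +-congˡ (*-congˡ (geometric-suc m x y)) ⟨
    y * y ^ m + x * geometric (suc m) x y        ∎
    where G = geometric m x y

  -- All n summands equal yⁿ⁻¹, and n = 0 in the field.
  geometric-diagonal : ∀ {x y} → x ≈ y → geometric n x y ≈ 0#
  geometric-diagonal {x} {y} x≈y = begin
    geometric n x y                ≈⟨ sum-cong-≋ {n} (λ i → trans (*-congʳ (^-congˡ (toℕ i) x≈y))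
                                        (trans (sym (^-homo-* y (toℕ i) _)) (^-congʳ y (exponent i)))) ⟩
    ∑[ i < n ] (y ^ ℕ.pred n)      ≈⟨ sum-replicate n ⟩
    n ×ᶠ (y ^ ℕ.pred n)            ≈⟨ ×-congʳ n (*-identityˡ _) ⟨
    n ×ᶠ (1# * y ^ ℕ.pred n)       ≈⟨ ×-assoc-* n 1# _ ⟨
    n ×ᶠ 1# * y ^ ℕ.pred n         ≈⟨ *-congʳ order×1≈0 ⟩
    0# * y ^ ℕ.pred n              ≈⟨ zeroˡ _ ⟩
    0#                             ∎
    where
    exponent : ∀ {m} (i : Fin m) → toℕ i ℕ.+ (m ℕ.∸ suc (toℕ i)) ≡ ℕ.pred m
    exponent {suc m} i = ℕ.m+[n∸m]≡n (Fin.toℕ≤pred[n] i)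

  -- As xⁿ = x and yⁿ = y, the geometric identity reads (x - y) G = x - y.
  geometric-off-diagonal : ∀ {x y} → x ≉ y → geometric n x y ≈ 1#
  geometric-off-diagonal {x} {y} x≉y with cross-cancel {x} {y} {geometric n x y} {1#} (begin
    x * G + y * 1#   ≈⟨ +-congˡ (trans (*-identityʳ y) (sym (x^order≈x y))) ⟩
    x * G + y ^ n    ≈⟨ +-comm _ _ ⟩
    y ^ n + x * G    ≈⟨ geometric-identity n x y ⟨
    x ^ n + y * G    ≈⟨ +-congʳ (trans (*-identityʳ x) (sym (x^order≈x x))) ⟨
    x * 1# + y * G   ∎)
    where G = geometric n x y
  ... | inj₁ x≈y = contradiction x≈y x≉y
  ... | inj₂ G≈1 = G≈1

  -- δ s i is the coefficient of xⁱ in the constant polynomial s.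
  δ : Carrier → ℕ → Carrier
  δ s zero    = s
  δ s (suc _) = 0#

  -- Read off from f x = Σ f y - Σ f y · G(x, y), with G the geometric sum, by collecting powers of
  -- x. The explicit power sums make it possible to apply φ to each coefficient.
  coefficients : (Carrier → Carrier) → Vector Carrier n
  coefficients f i =
    δ (sum (f ∘ elem)) (toℕ i) + - ∑[ j < n ] (f (elem j) * elem j ^ (n ℕ.∸ suc (toℕ i)))

  -- geometric n x y is 1 − [x = y], so f x + Σ_y f y · geometric n x y = Σ_y f y.
  evaluate-coefficients : ∀ {f : Carrier → Carrier} → (∀ {x y} → x ≈ y → f x ≈ f y) →
                          ∀ x → f x ≈ evaluate F (coefficients f) x
  evaluate-coefficients {f} f-cong x = +-cancelʳ A _ _ (begin
    f x + A                                                     ≈⟨ +-congʳ (f-cong (elem-index x)) ⟨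
    f (elem (index x)) + A                                      ≈⟨ SumUpdate.sum-update +-commutativeMonoid (f ∘ elem) _ (index x)
                                                                     (trans (*-congˡ (geometric-diagonal (sym (elem-index x)))) (zeroʳ _))
                                                                     (λ i i≢x → trans (*-congˡ (geometric-off-diagonal (λ x≈i → i≢x (≡.sym (≡.trans (Enum.to-cong x≈i) (index-elem i)))))) (*-identityʳ _)) ⟩
    S                                                           ≈⟨ sum-δ n (index x) ⟨
    sum (λ (i : Fin n) → δ S (toℕ i) * x ^ toℕ i)               ≈⟨ sum-cong-≋ {n} (λ i → split (toℕ i)) ⟨
    sum (λ i → coefficients f i * x ^ toℕ i + b (toℕ i) * x ^ toℕ i) ≈⟨ ∑-distrib-+ {n} _ _ ⟩
    evaluate F (coefficients f) x + sum (λ (i : Fin n) → b (toℕ i) * x ^ toℕ i) ≈⟨ +-congˡ exchange ⟨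
    evaluate F (coefficients f) x + A                           ∎)
    where
    S = sum (f ∘ elem)
    A = ∑[ j < n ] (f (elem j) * geometric n x (elem j))
    b : ℕ → Carrier
    b i = ∑[ j < n ] (f (elem j) * elem j ^ (n ℕ.∸ suc i))

    exchange : A ≈ sum (λ (i : Fin n) → b (toℕ i) * x ^ toℕ i)
    exchange = begin
      A ≈⟨ sum-cong-≋ {n} (λ j → *-distribˡ-sum {n} (f (elem j)) _) ⟩
      ∑[ j < n ] ∑[ i < n ] (f (elem j) * (x ^ toℕ i * elem j ^ (n ℕ.∸ suc (toℕ i)))) ≈⟨ ∑-comm {n} {n} _ ⟩
      ∑[ i < n ] ∑[ j < n ] (f (elem j) * (x ^ toℕ i * elem j ^ (n ℕ.∸ suc (toℕ i))))
        ≈⟨ sum-cong-≋ {n} (λ i → sum-cong-≋ {n} (λ j → solve 3 (λ f x y → f :* (x :* y) := f :* y :* x) refl (f (elem j)) (x ^ toℕ i) (elem j ^ (n ℕ.∸ suc (toℕ i))))) ⟩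
      ∑[ i < n ] ∑[ j < n ] (f (elem j) * elem j ^ (n ℕ.∸ suc (toℕ i)) * x ^ toℕ i)
        ≈⟨ sum-cong-≋ {n} (λ i → *-distribʳ-sum {n} (x ^ toℕ i) _) ⟨
      ∑[ i < n ] (b (toℕ i) * x ^ toℕ i) ∎

    split : ∀ i → (δ S i + - b i) * x ^ i + b i * x ^ i ≈ δ S i * x ^ i
    split i = begin
      (δ S i + - b i) * x ^ i + b i * x ^ i ≈⟨ distribʳ (x ^ i) _ _ ⟨
      (δ S i + - b i + b i) * x ^ i         ≈⟨ *-congʳ (+-assoc _ _ _) ⟩
      (δ S i + (- b i + b i)) * x ^ i       ≈⟨ *-congʳ (+-congˡ (-‿inverseˡ _)) ⟩
      (δ S i + 0#) * x ^ i                  ≈⟨ *-congʳ (+-identityʳ _) ⟩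
      δ S i * x ^ i                         ∎

    sum-δ : ∀ m → Fin m → sum (λ (i : Fin m) → δ S (toℕ i) * x ^ toℕ i) ≈ S
    sum-δ (suc m) _ = begin
      S * 1# + sum (λ (i : Fin m) → 0# * x ^ suc (toℕ i)) ≈⟨ +-cong (*-identityʳ S) (sum-cong-≋ {m} (λ i → zeroˡ _)) ⟩
      S + sum {m} (const 0#)                              ≈⟨ +-congˡ (sum-replicate-zero m) ⟩
      S + 0#                                              ≈⟨ +-identityʳ S ⟩
      S                                                   ∎

-- Binomial coefficients modulo a prime, and injections of finite sets

prime∤! : ∀ {p k} → Prime p → k ℕ.< p → ¬ p ∣ k !
prime∤! {k = zero}  pr k<p p∣1 = ℕ.<⇒≱ (ℕ.nonTrivial⇒n>1 _ {{prime⇒nonTrivial pr}}) (∣⇒≤ p∣1)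
prime∤! {k = suc k} pr k<p p∣k! with euclidsLemma (suc k) (k !) pr p∣k!
... | inj₁ p∣k = ℕ.<⇒≱ k<p (∣⇒≤ p∣k)
... | inj₂ p∣! = prime∤! pr (ℕ.<-trans (ℕ.n<1+n k) k<p) p∣!

prime∣C : ∀ {p k} → Prime p → 0 ℕ.< k → k ℕ.< p → p ∣ p C k
prime∣C {p} {k} pr 0<k k<p
  with euclidsLemma (p C k) (k ! ℕ.* (p ℕ.∸ k) !) pr
         (≡.subst (p ∣_) (≡.sym C*!) (n∣n! p {{prime⇒nonZero pr}}))
  where
  instance _ = k ℕ.!* (p ℕ.∸ k) !≢0
  C*! : (p C k) ℕ.* (k ! ℕ.* (p ℕ.∸ k) !) ≡ p !
  C*! = ≡.trans (≡.cong (ℕ._* (k ! ℕ.* (p ℕ.∸ k) !)) (nCk≡n!/k![n-k]! (ℕ.<⇒≤ k<p)))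
                (m/n*n≡m (k![n∸k]!∣n! (ℕ.<⇒≤ k<p)))
  n∣n! : ∀ n → .{{NonZero n}} → n ∣ n !
  n∣n! (suc n) = m∣m*n (n !)
... | inj₁ p∣C = p∣C
... | inj₂ p∣! with euclidsLemma (k !) ((p ℕ.∸ k) !) pr p∣!
...   | inj₁ p∣k!   = contradiction p∣k! (prime∤! pr k<p)
...   | inj₂ p∣p-k! = contradiction p∣p-k! (prime∤! pr (ℕ.∸-monoʳ-< 0<k (ℕ.<⇒≤ k<p)))

-- If j were missed, `punchOut` at j would give an injection into a set with one element fewer.
injective⇒surjective : ∀ {n} {f : Fin n → Fin n} → (∀ {i j} → f i ≡ f j → i ≡ j) → ∀ j → ∃[ i ] f i ≡ j
injective⇒surjective {suc n} {f} inj j with Fin.any? (λ i → f i Fin.≟ j)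
... | yes hit = hit
... | no miss = contradiction
  (λ {i} {k} eq → inj (Fin.punchOut-injective (miss′ i) (miss′ k) eq))
  (Fin.<⇒notInjective {f = λ i → punchOut (miss′ i)} ℕ.≤-refl)
  where
  miss′ : ∀ i → j ≢ f i
  miss′ i eq = miss (i , ≡.sym eq)

-- Roots of polynomial functions

module Roots {c ℓ n} (F : FiniteField c ℓ n) where

  open FieldProperties F

  -- f is a polynomial function of degree at most m with coefficient a at xᵐ;
  -- g is the divided difference (f x − f r) / (x − r).
  data Poly (a : Carrier) : ℕ → (Carrier → Carrier) → Set (c ⊔ ℓ) where
    constant : ∀ {f} → (∀ x → f x ≈ a) → Poly a zero f
    divided  : ∀ {m f} → (∀ r → Σ[ g ∈ (Carrier → Carrier) ]
                 Poly a m g × (∀ x → f x + r * g x ≈ f r + x * g x)) → Poly a (suc m) f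

  Poly-cong : ∀ {a b m f} → a ≈ b → Poly a m f → Poly b m f
  Poly-cong a≈b (constant h) = constant (λ x → trans (h x) a≈b)
  Poly-cong a≈b (divided h)  = divided λ r → let g , P , eq = h r in g , Poly-cong a≈b P , eq

  Poly-+ : ∀ {a b m f g} → Poly a m f → Poly b m g → Poly (a + b) m (λ x → f x + g x)
  Poly-+ (constant h) (constant k) = constant (λ x → +-cong (h x) (k x))
  Poly-+ {f = f} {g} (divided h) (divided k) = divided λ r →
    let f′ , P , eq = h r ; g′ , Q , eq′ = k r in
    (λ x → f′ x + g′ x) , Poly-+ P Q , λ x → begin
      f x + g x + r * (f′ x + g′ x)        ≈⟨ lem (f x) (g x) r (f′ x) (g′ x) ⟩
      (f x + r * f′ x) + (g x + r * g′ x)  ≈⟨ +-cong (eq x) (eq′ x) ⟩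
      (f r + x * f′ x) + (g r + x * g′ x)  ≈⟨ lem (f r) (g r) x (f′ x) (g′ x) ⟨
      f r + g r + x * (f′ x + g′ x)        ∎
    where
    lem : ∀ a b r u v → a + b + r * (u + v) ≈ (a + r * u) + (b + r * v)
    lem = solve 5 (λ a b r u v → a :+ b :+ r :* (u :+ v) := (a :+ r :* u) :+ (b :+ r :* v)) refl

  Poly-* : ∀ {a m f} b → Poly a m f → Poly (b * a) m (λ x → b * f x)
  Poly-* b (constant h) = constant (λ x → *-congˡ (h x))
  Poly-* {f = f} b (divided h) = divided λ r → let g , P , eq = h r in
    (λ x → b * g x) , Poly-* b P , λ x → begin
      b * f x + r * (b * g x)  ≈⟨ lem b (f x) r (g x) ⟩
      b * (f x + r * g x)      ≈⟨ *-congˡ (eq x) ⟩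
      b * (f r + x * g x)      ≈⟨ lem b (f r) x (g x) ⟨
      b * f r + x * (b * g x)  ∎
    where
    lem : ∀ b f r g → b * f + r * (b * g) ≈ b * (f + r * g)
    lem = solve 4 (λ b f r g → b :* f :+ r :* (b :* g) := b :* (f :+ r :* g)) refl

  Poly-raise : ∀ {a m f} → Poly a m f → Poly 0# (suc m) f
  Poly-raise (constant h) = divided λ r → const 0# , constant (λ _ → refl) ,
    λ x → +-cong (trans (h x) (sym (h r))) (trans (zeroʳ r) (sym (zeroʳ x)))
  Poly-raise (divided h) = divided λ r → let g , P , eq = h r in g , Poly-raise P , eq

  Poly-raise* : ∀ {m f} k → Poly 0# m f → Poly 0# (k ℕ.+ m) f
  Poly-raise* zero    P = P
  Poly-raise* (suc k) P = Poly-raise (Poly-raise* k P)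

  -- The divided difference of x f(x) at r is f(x) + r g(x). The second summand has lower degree, so
  -- the leading coefficient stays a.
  Poly-shift : ∀ {a m f} → Poly a m f → Poly a (suc m) (λ x → x * f x)
  Poly-shift {f = f} P@(constant h) = divided λ r → f , P , λ x → begin
    x * f x + r * f x  ≈⟨ +-comm _ _ ⟩
    r * f x + x * f x  ≈⟨ +-congʳ (*-congˡ (trans (h x) (sym (h r)))) ⟩
    r * f r + x * f x  ∎
  Poly-shift {a} {f = f} P@(divided h) = divided λ r → let g , Q , eq = h r in
    (λ x → f x + r * g x) ,
    Poly-cong (trans (+-congˡ (zeroʳ r)) (+-identityʳ a)) (Poly-+ P (Poly-* r (Poly-raise Q))) ,
    λ x → begin
      x * f x + r * (f x + r * g x)        ≈⟨ +-congˡ (*-congˡ (eq x)) ⟩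
      x * f x + r * (f r + x * g x)        ≈⟨ solve 5 (λ x f r e g → x :* f :+ r :* (e :+ x :* g) := r :* e :+ x :* (f :+ r :* g)) refl x (f x) r (f r) (g x) ⟩
      r * f r + x * (f x + r * g x)        ∎

  Poly-^ : ∀ m → Poly 1# m (_^ m)
  Poly-^ zero    = constant (λ _ → refl)
  Poly-^ (suc m) = Poly-shift (Poly-^ m)

  -- Division by x - ρ₀ keeps the other roots and lowers the degree, until the constant 1, which has
  -- no root, is reached. In this form the bound on the number of roots names the root that x
  -- equals.
  monic-roots : ∀ {m f} → Poly 1# m f → (ρ : Fin m → Carrier) →
                (∀ {i j} → ρ i ≈ ρ j → i ≡ j) → (∀ i → f (ρ i) ≈ 0#) →
                ∀ {x} → f x ≈ 0# → ∃[ i ] x ≈ ρ i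
  monic-roots (constant h) ρ ρ-inj root {x} fx≈0 = contradiction (trans (sym fx≈0) (h x)) 0≉1
  monic-roots {f = f} (divided h) ρ ρ-inj root {x} fx≈0
    with g , P , eq ← h (ρ zero) = result
    where
    next : ∀ {y} → f y ≈ 0# → y ≈ ρ zero ⊎ g y ≈ 0#
    next {y} fy≈0 = cross-cancel (begin
      y * g y + ρ zero * 0#       ≈⟨ +-congˡ (trans (zeroʳ _) (sym (root zero))) ⟩
      y * g y + f (ρ zero)        ≈⟨ +-comm _ _ ⟩
      f (ρ zero) + y * g y        ≈⟨ eq y ⟨
      f y + ρ zero * g y          ≈⟨ +-congʳ (trans fy≈0 (sym (zeroʳ y))) ⟩
      y * 0# + ρ zero * g y       ∎)
    root′ : ∀ i → g (ρ (suc i)) ≈ 0#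
    root′ i with next (root (suc i))
    ... | inj₁ eq = contradiction (ρ-inj eq) λ ()
    ... | inj₂ g≈0 = g≈0
    result : ∃[ i ] x ≈ ρ i
    result with next fx≈0
    ... | inj₁ x≈ρ0 = zero , x≈ρ0
    ... | inj₂ gx≈0 = let i , eq = monic-roots P (ρ ∘ suc) (Fin.suc-injective ∘ ρ-inj) root′ gx≈0
                      in suc i , eq

-- The Frobenius map of a field of order pᵖ

module Frobenius {c ℓ p} (pr : Prime p) (F : FiniteField c ℓ (p ℕ.^ p)) where

  open FieldProperties F public
  open Roots F

  instance
    p≢0 : NonZero p
    p≢0 = prime⇒nonZero pr

  φ : Carrier → Carrier
  φ x = x ^ p

  φ-cong : ∀ {x y} → x ≈ y → φ x ≈ φ y
  φ-cong = ^-congˡ p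

  -- The p-th power of p · 1 is pᵖ · 1 = 0, and a field has no nilpotents.
  characteristic : p ×ᶠ 1# ≈ 0#
  characteristic with p ×ᶠ 1# ≟ 0#
  ... | yes p≈0 = p≈0
  ... | no p≉0 = contradiction (trans (sym (power p)) order×1≈0) (^-≉0 p p≉0)
    where
    power : ∀ k → (p ℕ.^ k) ×ᶠ 1# ≈ (p ×ᶠ 1#) ^ k
    power zero    = +-identityʳ 1#
    power (suc k) = trans (×1-homo-* p (p ℕ.^ k)) (*-congˡ (power k))

  ∣⇒×≈0 : ∀ {m} → p ∣ m → ∀ x → m ×ᶠ x ≈ 0#
  ∣⇒×≈0 {m} (divides q ≡.refl) x = begin
    (q ℕ.* p) ×ᶠ x                ≈⟨ ×-congʳ (q ℕ.* p) (*-identityˡ x) ⟨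
    (q ℕ.* p) ×ᶠ (1# * x)         ≈⟨ ×-assoc-* (q ℕ.* p) 1# x ⟨
    (q ℕ.* p) ×ᶠ 1# * x           ≈⟨ *-congʳ (×1-homo-* q p) ⟩
    q ×ᶠ 1# * p ×ᶠ 1# * x         ≈⟨ *-congʳ (*-congˡ characteristic) ⟩
    q ×ᶠ 1# * 0# * x              ≈⟨ *-congʳ (zeroʳ _) ⟩
    0# * x                        ≈⟨ zeroˡ x ⟩
    0#                            ∎

  -- Serves the binomial theorem. The last index is returned with an equation for its `toℕ`, by
  -- which `last` can rewrite.
  sum-ends : ∀ {m} (t : Vector Carrier (suc (suc m))) →
                  (∀ i → toℕ i ≢ 0 → toℕ i ℕ.< suc m → t i ≈ 0#) →
                  ∃[ l ] toℕ l ≡ suc m × sum t ≈ t zero + t l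
  sum-ends {m} t mid = suc (fromℕ m) , ≡.cong suc (Fin.toℕ-fromℕ m) , +-congˡ (begin
    sum (t ∘ suc)                                    ≈⟨ sum-init-last (t ∘ suc) ⟩
    sum (t ∘ suc ∘ inject₁) + t (suc (fromℕ m))  ≈⟨ +-congʳ (trans (sum-cong-≋ {m} (λ i → mid _ (λ ()) (s≤s (≡.subst (ℕ._< m) (≡.sym (Fin.toℕ-inject₁ i)) (Fin.toℕ<n i))))) (sum-replicate-zero m)) ⟩
    0# + t (suc (fromℕ m))                       ≈⟨ +-identityˡ _ ⟩
    t (suc (fromℕ m))                            ∎)

  φ-+ : ∀ x y → φ (x + y) ≈ φ x + φ y
  φ-+ x y = expand p ≡.refl
    where
    open Binomial commutativeSemiring using (theorem; binomialTerm)
    -- Matching on q exposes p as a successor, the shape that `sum-ends` requires.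
    expand : ∀ q → q ≡ p → (x + y) ^ q ≈ x ^ q + y ^ q
    expand zero    q≡p = contradiction (≡.sym q≡p) (ℕ.≢-nonZero⁻¹ p)
    expand (suc m) ≡.refl with l , l≡p , eq ← sum-ends (binomialTerm x y p)
      (λ i i≢0 i<p → ∣⇒×≈0 (prime∣C pr (ℕ.n≢0⇒n>0 i≢0) i<p) _) = begin
        (x + y) ^ p                                    ≈⟨ theorem p x y ⟩
        sum (binomialTerm x y p)                       ≈⟨ eq ⟩
        binomialTerm x y p zero + binomialTerm x y p l ≈⟨ +-cong first last ⟩
        y ^ p + x ^ p                                  ≈⟨ +-comm _ _ ⟩
        x ^ p + y ^ p                                  ∎
      where
      first : binomialTerm x y p zero ≈ y ^ p
      first = trans (+-identityʳ _) (*-identityˡ _)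
      last : binomialTerm x y p l ≈ x ^ p
      last rewrite l≡p | nCn≡1 p | ℕ.n∸n≡0 m = trans (+-identityʳ _) (*-identityʳ _)

  φ-* : ∀ x y → φ (x * y) ≈ φ x * φ y
  φ-* x y = ^-distrib-* x y p

  φ-1 : φ 1# ≈ 1#
  φ-1 = go p
    where
    go : ∀ m → 1# ^ m ≈ 1#
    go zero    = refl
    go (suc m) = trans (*-identityˡ _) (go m)

  φ-0 : φ 0# ≈ 0#
  φ-0 = +-cancelʳ (φ 0#) _ _ (begin
    φ 0# + φ 0#  ≈⟨ φ-+ 0# 0# ⟨
    φ (0# + 0#)  ≈⟨ φ-cong (+-identityˡ 0#) ⟩
    φ 0#         ≈⟨ +-identityˡ _ ⟨
    0# + φ 0#    ∎)

  φ-neg : ∀ x → φ (- x) ≈ - φ x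
  φ-neg x = +-cancelʳ (φ x) _ _ (begin
    φ (- x) + φ x  ≈⟨ φ-+ (- x) x ⟨
    φ (- x + x)    ≈⟨ φ-cong (-‿inverseˡ x) ⟩
    φ 0#           ≈⟨ φ-0 ⟩
    0#             ≈⟨ -‿inverseˡ (φ x) ⟨
    - φ x + φ x    ∎)

  φ-^ : ∀ x m → φ (x ^ m) ≈ φ x ^ m
  φ-^ x zero    = φ-1
  φ-^ x (suc m) = trans (φ-* x (x ^ m)) (*-congˡ (φ-^ x m))

  φ-sum : ∀ {m} (t : Vector Carrier m) → φ (sum t) ≈ sum (φ ∘ t)
  φ-sum {zero}  t = φ-0
  φ-sum {suc m} t = trans (φ-+ (t zero) _) (+-congˡ (φ-sum (t ∘ suc)))

  Fixed : Pred Carrier ℓ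
  Fixed x = φ x ≈ x

  ι : Fin p → Carrier
  ι i = toℕ i ×ᶠ 1#

  ι-fixed : ∀ i → Fixed (ι i)
  ι-fixed i = go (toℕ i)
    where
    go : ∀ m → Fixed (m ×ᶠ 1#)
    go zero    = φ-0
    go (suc m) = trans (φ-+ 1# _) (+-cong φ-1 (go m))

  bézout⇒1≈0 : ∀ b m a k → m ×ᶠ 1# ≈ 0# → k ×ᶠ 1# ≈ 0# →
               1 ℕ.+ b ℕ.* m ≡ a ℕ.* k → 1# ≈ 0#
  bézout⇒1≈0 b m a k m≈0 k≈0 eq = begin
    1#                           ≈⟨ +-identityʳ 1# ⟨
    1# + 0#                      ≈⟨ +-congˡ (zeroʳ _) ⟨
    1# + (b ×ᶠ 1#) * 0#          ≈⟨ +-congˡ (*-congˡ m≈0) ⟨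
    1# + (b ×ᶠ 1#) * (m ×ᶠ 1#)   ≈⟨ +-congˡ (×1-homo-* b m) ⟨
    (1 ℕ.+ b ℕ.* m) ×ᶠ 1#        ≈⟨ ×-congˡ eq ⟩
    (a ℕ.* k) ×ᶠ 1#              ≈⟨ ×1-homo-* a k ⟩
    (a ×ᶠ 1#) * (k ×ᶠ 1#)        ≈⟨ *-congˡ k≈0 ⟩
    (a ×ᶠ 1#) * 0#               ≈⟨ zeroʳ _ ⟩
    0#                           ∎

  -- By Bézout 1 is an integral combination of m and p; if m vanished in the field, so would 1.
  ×1≉0 : ∀ m → .{{NonZero m}} → m ℕ.< p → m ×ᶠ 1# ≉ 0#
  ×1≉0 m m<p m≈0 with coprime-Bézout (prime⇒coprime pr m<p)
  ... | Bézout.+- a b eq = 0≉1 (sym (bézout⇒1≈0 b m a p m≈0 characteristic eq))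
  ... | Bézout.-+ a b eq = 0≉1 (sym (bézout⇒1≈0 a p b m characteristic m≈0 eq))

  ×1-distinct : ∀ {k m} → k ℕ.< m → m ℕ.< p → k ×ᶠ 1# ≉ m ×ᶠ 1#
  ×1-distinct {k} {m} k<m m<p eq =
    ×1≉0 (m ℕ.∸ k) {{ℕ.>-nonZero (ℕ.m<n⇒0<n∸m k<m)}} (ℕ.≤-<-trans (ℕ.m∸n≤m m k) m<p)
      (+-cancelˡ (k ×ᶠ 1#) _ _ (begin
        k ×ᶠ 1# + (m ℕ.∸ k) ×ᶠ 1#  ≈⟨ ×-homo-+ 1# k (m ℕ.∸ k) ⟨
        (k ℕ.+ (m ℕ.∸ k)) ×ᶠ 1#    ≈⟨ ×-congˡ (ℕ.m+[n∸m]≡n (ℕ.<⇒≤ k<m)) ⟩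
        m ×ᶠ 1#                    ≈⟨ eq ⟨
        k ×ᶠ 1#                    ≈⟨ +-identityʳ _ ⟨
        k ×ᶠ 1# + 0#               ∎))

  ι-injective : ∀ {i j} → ι i ≈ ι j → i ≡ j
  ι-injective {i} {j} eq with ℕ.<-cmp (toℕ i) (toℕ j)
  ... | tri< i<j _ _ = contradiction eq (×1-distinct i<j (Fin.toℕ<n j))
  ... | tri≈ _ i≡j _ = Fin.toℕ-injective i≡j
  ... | tri> _ _ j<i = contradiction (sym eq) (×1-distinct j<i (Fin.toℕ<n i))

  fixed⇒ι : ∀ {x} → Fixed x → ∃[ i ] x ≈ ι i
  fixed⇒ι {x} fx = monic-roots monic ι ι-injective (λ i → root (ι-fixed i)) (root fx)
    where
    root : ∀ {x} → Fixed x → x ^ p + - 1# * x ^ 1 ≈ 0#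
    root {x} fx = begin
      x ^ p + - 1# * x ^ 1   ≈⟨ +-cong (sym (*-identityˡ _)) (*-congˡ (trans (*-identityʳ x) (sym fx))) ⟩
      1# * x ^ p + - 1# * x ^ p ≈⟨ distribʳ (x ^ p) 1# (- 1#) ⟨
      (1# + - 1#) * x ^ p    ≈⟨ *-congʳ (-‿inverseʳ 1#) ⟩
      0# * x ^ p             ≈⟨ zeroˡ _ ⟩
      0#                     ∎
    p≡ : p ℕ.∸ 2 ℕ.+ 2 ≡ p
    p≡ = ℕ.m∸n+n≡m (ℕ.nonTrivial⇒n>1 p {{prime⇒nonTrivial pr}})
    -- The term -x has degree 1; it is raised to formal degree p with leading coefficient 0, which
    -- uses p ≥ 2, so that the sum stays monic.
    monic : Poly 1# p (λ x → x ^ p + - 1# * x ^ 1)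
    monic = Poly-cong (trans (+-congˡ (zeroʳ _)) (+-identityʳ 1#))
      (Poly-+ (Poly-^ p) (Poly-* (- 1#)
        (≡.subst (λ q → Poly 0# q (_^ 1)) p≡ (Poly-raise* (p ℕ.∸ 2) (Poly-raise (Poly-^ 1))))))

  fixed⇒𝔽 : ∀ {x} → Fixed x → 𝔽 F p x
  fixed⇒𝔽 fx = Fixed , isSubfield , cardinal , fx
    where
    isSubfield : IsSubfield F Fixed
    isSubfield = record
      { resp-≈     = λ x≈y fx → trans (φ-cong (sym x≈y)) (trans fx x≈y)
      ; 0#-closed  = φ-0
      ; 1#-closed  = φ-1
      ; +-closed   = λ fx fy → trans (φ-+ _ _) (+-cong fx fy)
      ; neg-closed = λ fx → trans (φ-neg _) (-‿cong fx)
      ; *-closed   = λ fx fy → trans (φ-* _ _) (*-cong fx fy)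
      ; inv-closed = λ {x} {y} fx xy≈1 → *-cancelˡ {x} (x≉0 xy≈1) (begin
          x * φ y    ≈⟨ *-congʳ fx ⟨
          φ x * φ y  ≈⟨ φ-* x y ⟨
          φ (x * y)  ≈⟨ φ-cong xy≈1 ⟩
          φ 1#       ≈⟨ φ-1 ⟩
          1#         ≈⟨ xy≈1 ⟨
          x * y      ∎)
      }
      where
      x≉0 : ∀ {x y} → x * y ≈ 1# → x ≉ 0#
      x≉0 {x} {y} xy≈1 x≈0 = 0≉1 (trans (sym (zeroˡ y)) (trans (*-congʳ (sym x≈0)) xy≈1))
    root : ∀ x → Fixed x → ∃[ i ] x ≈ ι i
    root x = fixed⇒ι
    cardinal : HasCardinality (subsetSetoid F Fixed) p
    cardinal = record
      { to        = λ (x , fx) → proj₁ (root x fx)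
      ; from      = λ i → ι i , ι-fixed i
      ; to-cong   = λ { {x , fx} {y , fy} x≈y → ι-injective
                        (trans (sym (proj₂ (root x fx))) (trans x≈y (proj₂ (root y fy)))) }
      ; from-cong = λ { ≡.refl → refl }
      ; inverse   = (λ { {i} {x , fx} x≈ι → ι-injective (trans (sym (proj₂ (root x fx))) x≈ι) })
                  , (λ { {x , fx} ≡.refl → sym (proj₂ (root x fx)) })
      }

  -- A subfield K contains all multiples of 1. The p distinct `ι i` thus inject into K, which has p
  -- elements, and so fill it.
  𝔽⇒fixed : ∀ {x} → 𝔽 F p x → Fixed x
  𝔽⇒fixed {x} (K , isSubfield , cardinal , x∈K) =
    trans (φ-cong (sym ιi≈x)) (trans (ι-fixed i) ιi≈x)
    where
    open IsSubfield isSubfield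
    module C = Inverse cardinal
    ×1∈K : ∀ m → K (m ×ᶠ 1#)
    ×1∈K zero    = 0#-closed
    ×1∈K (suc m) = +-closed 1#-closed (×1∈K m)
    injective : ∀ {y z} → C.to y ≡ C.to z → proj₁ y ≈ proj₁ z
    injective {y} {z} eq = trans (sym (C.strictlyInverseʳ y))
      (trans (C.from-cong eq) (C.strictlyInverseʳ z))
    hit = injective⇒surjective {f = λ i → C.to (ι i , ×1∈K (toℕ i)) }
            (ι-injective ∘ injective) (C.to (x , x∈K))
    i = proj₁ hit
    ιi≈x : ι i ≈ x
    ιi≈x = injective (proj₂ hit)

  everything∈𝔽 : ∀ x → 𝔽 F (p ℕ.^ p) x
  everything∈𝔽 x = (λ x → x ≈ x) , isSubfield , cardinal , refl
    where
    isSubfield : IsSubfield F (λ x → x ≈ x)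
    isSubfield = record
      { resp-≈ = λ _ _ → refl ; 0#-closed = refl ; 1#-closed = refl ; +-closed = λ _ _ → refl
      ; neg-closed = λ _ → refl ; *-closed = λ _ _ → refl ; inv-closed = λ _ _ → refl }
    cardinal : HasCardinality (subsetSetoid F (λ x → x ≈ x)) (p ℕ.^ p)
    cardinal = record
      { to        = λ (x , _) → index x
      ; from      = λ i → elem i , refl
      ; to-cong   = Enum.to-cong
      ; from-cong = Enum.from-cong
      ; inverse   = Enum.inverseˡ , Enum.inverseʳ
      }

  -- This is φ iterated p - 1 times; it inverts φ because x^(pᵖ) = x.
  φ⁻¹ : Carrier → Carrier
  φ⁻¹ x = x ^ (p ℕ.^ ℕ.pred p)

  p^p≡ : p ℕ.* p ℕ.^ ℕ.pred p ≡ p ℕ.^ p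
  p^p≡ = ≡.cong (p ℕ.^_) (ℕ.suc-pred p)

  φφ⁻¹ : ∀ x → φ (φ⁻¹ x) ≈ x
  φφ⁻¹ x = begin
    (x ^ (p ℕ.^ ℕ.pred p)) ^ p     ≈⟨ ^-assocʳ x (p ℕ.^ ℕ.pred p) p ⟩
    x ^ (p ℕ.^ ℕ.pred p ℕ.* p)     ≈⟨ ^-congʳ x (≡.trans (ℕ.*-comm _ p) p^p≡) ⟩
    x ^ (p ℕ.^ p)                  ≈⟨ x^order≈x x ⟩
    x                              ∎

  φ⁻¹φ : ∀ x → φ⁻¹ (φ x) ≈ x
  φ⁻¹φ x = begin
    (x ^ p) ^ (p ℕ.^ ℕ.pred p)     ≈⟨ ^-assocʳ x p _ ⟩
    x ^ (p ℕ.* p ℕ.^ ℕ.pred p)     ≈⟨ ^-congʳ x p^p≡ ⟩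
    x ^ (p ℕ.^ p)                  ≈⟨ x^order≈x x ⟩
    x                              ∎

  Equivariant Preserving : (Carrier → Carrier) → Set (c ⊔ ℓ)
  Equivariant f = ∀ x → f (φ x) ≈ φ (f x)
  Preserving  f = ∀ x → ¬ Fixed x → ¬ Fixed (f x)

  module _ {f : Map F} where

    coefficientsInBase⇒equivariant : CoefficientsInBase p p F f → Equivariant (f ⟨$⟩_)
    coefficientsInBase⇒equivariant (a , f≈a , a∈𝔽) x = begin
      f ⟨$⟩ φ x                                         ≈⟨ f≈a (φ x) ⟩
      evaluate F a (φ x)                                ≈⟨ sum-cong-≋ {p ℕ.^ p} (λ i → trans (φ-* _ _) (*-cong (𝔽⇒fixed (a∈𝔽 i)) (φ-^ x (toℕ i)))) ⟨
      sum (λ i → φ (a i * x ^ toℕ i))                   ≈⟨ φ-sum {p ℕ.^ p} _ ⟨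
      φ (evaluate F a x)                                ≈⟨ φ-cong (f≈a x) ⟨
      φ (f ⟨$⟩ x)                                       ∎

    -- Applying φ to a power sum Σ f(y) yᵏ replaces y by φ y in each summand, and y ↦ φ y is a
    -- bijection, so the sum is fixed by φ.
    equivariant⇒coefficientsInBase : Equivariant (f ⟨$⟩_) → CoefficientsInBase p p F f
    equivariant⇒coefficientsInBase equivariant =
      coefficients (f ⟨$⟩_) , evaluate-coefficients f-cong , λ i → fixed⇒𝔽 (begin
        φ (coefficients (f ⟨$⟩_) i)                         ≈⟨ φ-+ _ _ ⟩
        φ (δ S (toℕ i)) + φ (- power-sum i)                 ≈⟨ +-cong (δ-fixed (toℕ i)) (trans (φ-neg _) (-‿cong (power-sum-fixed i))) ⟩
        coefficients (f ⟨$⟩_) i                             ∎)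
      where
      f-cong = Func.cong f
      S = sum (λ j → f ⟨$⟩ elem j)
      power-sum : Fin (p ℕ.^ p) → Carrier
      power-sum i = ∑[ j < p ℕ.^ p ] ((f ⟨$⟩ elem j) * elem j ^ (p ℕ.^ p ℕ.∸ suc (toℕ i)))
      module B = Bijection φ φ⁻¹ φ-cong (^-congˡ (p ℕ.^ ℕ.pred p)) φφ⁻¹ φ⁻¹φ

      S-fixed : Fixed S
      S-fixed = begin
        φ S                                ≈⟨ φ-sum {p ℕ.^ p} _ ⟩
        sum (λ j → φ (f ⟨$⟩ elem j))       ≈⟨ sum-cong-≋ {p ℕ.^ p} (λ j → equivariant (elem j)) ⟨
        sum (λ j → f ⟨$⟩ φ (elem j))       ≈⟨ B.sum-reindex f-cong ⟨
        S                                  ∎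

      δ-fixed : ∀ k → Fixed (δ S k)
      δ-fixed zero    = S-fixed
      δ-fixed (suc k) = φ-0

      power-sum-fixed : ∀ i → Fixed (power-sum i)
      power-sum-fixed i = begin
        φ (power-sum i)                                         ≈⟨ φ-sum {p ℕ.^ p} _ ⟩
        ∑[ j < p ℕ.^ p ] φ ((f ⟨$⟩ elem j) * elem j ^ k)          ≈⟨ sum-cong-≋ {p ℕ.^ p} (λ j → trans (φ-* _ _) (*-cong (sym (equivariant (elem j))) (φ-^ (elem j) k))) ⟩
        ∑[ j < p ℕ.^ p ] ((f ⟨$⟩ φ (elem j)) * φ (elem j) ^ k)    ≈⟨ B.sum-reindex {λ y → (f ⟨$⟩ y) * y ^ k} (λ eq → *-cong (f-cong eq) (^-congˡ k eq)) ⟨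
        power-sum i                                             ∎
        where k = p ℕ.^ p ℕ.∸ suc (toℕ i)

    subfieldPreserving⇒preserving : SubfieldPreserving p p F f → Preserving (f ⟨$⟩_)
    subfieldPreserving⇒preserving sp x x∉ fx∈ =
      -- The case d = p, s = 1 of the condition, where the difference is the set of non-fixed
      -- points.
      proj₂ (difference p 1 ∣-refl (1∣ p)
              (everything∈𝔽 x , λ x∈ → x∉ (𝔽⇒fixed (≡.subst (λ q → 𝔽 F q x) (ℕ.^-identityʳ p) x∈))))
            (≡.subst (λ q → 𝔽 F q (f ⟨$⟩ x)) (≡.sym (ℕ.^-identityʳ p)) (fixed⇒𝔽 fx∈))
      where open SubfieldPreserving sp

    equivariant∧preserving⇒subfieldPreserving :
      Equivariant (f ⟨$⟩_) → Preserving (f ⟨$⟩_) → SubfieldPreserving p p F f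
    equivariant∧preserving⇒subfieldPreserving equivariant preserving = record
      { base       = λ {x} x∈ → fixed⇒𝔽 (trans (sym (equivariant x)) (Func.cong f (𝔽⇒fixed x∈)))
      ; difference = difference
      }
      where
      difference : ∀ d s → d ∣ p → s ∣ p → ∀ {x} →
        𝔽 F (p ℕ.^ d) x × ¬ 𝔽 F (p ℕ.^ s) x →
        𝔽 F (p ℕ.^ d) (f ⟨$⟩ x) × ¬ 𝔽 F (p ℕ.^ s) (f ⟨$⟩ x)
      difference d s d∣p s∣p {x} (x∈ , x∉) with prime⇒irreducible pr d∣p | prime⇒irreducible pr s∣p
      -- For s = p and for d = s = 1 the difference of subfields is empty; only d = p, s = 1 has
      -- content.
      ... | _           | inj₂ ≡.refl = contradiction (everything∈𝔽 x) x∉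
      ... | inj₁ ≡.refl | inj₁ ≡.refl = contradiction x∈ x∉
      ... | inj₂ ≡.refl | inj₁ ≡.refl = everything∈𝔽 _ , λ fx∈ →
        preserving x (λ fx → x∉ (≡.subst (λ q → 𝔽 F q x) (≡.sym (ℕ.^-identityʳ p)) (fixed⇒𝔽 fx)))
          (𝔽⇒fixed (≡.subst (λ q → 𝔽 F q (f ⟨$⟩ x)) (ℕ.^-identityʳ p) fx∈))

-- Permutations of prime order

module FreeOrbits where

  open import Data.Nat.DivMod using (_%_; _/_)
  open import Relation.Binary.PropositionalEquality

  -- Applied to the orbit representatives, this yields their number M and a duplicate-free list of
  -- them.
  enumerate : ∀ {n ℓ} {P : Pred (Fin n) ℓ} → Decidable P →
    ∃[ m ] Σ[ r ∈ (Fin m → Fin n) ]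
      (∀ j → P (r j)) × (∀ {i j} → r i ≡ r j → i ≡ j) × (∀ x → P x → ∃[ j ] r j ≡ x)
  enumerate {zero}  P? = 0 , (λ ()) , (λ ()) , (λ { {()} }) , λ ()
  enumerate {suc n} {P = P} P? with enumerate (P? ∘ suc) | P? zero
  ... | m , r , r∈ , inj , onto | yes p₀ = suc m , r′ , r′∈ , inj′ , onto′
    where
    r′ : Fin (suc m) → Fin (suc n)
    r′ zero    = zero
    r′ (suc j) = suc (r j)
    r′∈ : ∀ j → P (r′ j)
    r′∈ zero    = p₀
    r′∈ (suc j) = r∈ j
    inj′ : ∀ {i j} → r′ i ≡ r′ j → i ≡ j
    inj′ {zero}  {zero}  _  = refl
    inj′ {suc i} {suc j} eq = cong suc (inj (Fin.suc-injective eq))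
    onto′ : ∀ x → P x → ∃[ j ] r′ j ≡ x
    onto′ zero    _  = zero , refl
    onto′ (suc x) px = let j , eq = onto x px in suc j , cong suc eq
  ... | m , r , r∈ , inj , onto | no ¬p₀ =
    m , suc ∘ r , r∈ , inj ∘ Fin.suc-injective , onto′
    where
    onto′ : ∀ x → P x → ∃[ j ] suc (r j) ≡ x
    onto′ zero    px = contradiction px ¬p₀
    onto′ (suc x) px = let j , eq = onto x px in j , cong suc eq

  argmin : ∀ {n} → .{{NonZero n}} → (f : Fin n → ℕ) → ∃[ i ] ∀ j → f i ℕ.≤ f j
  argmin {suc zero} f = zero , λ { zero → ℕ.≤-refl }
  argmin {suc (suc n)} f with i , min ← argmin (f ∘ suc) | ℕ.≤-total (f zero) (f (suc i))
  ... | inj₁ f0≤ = zero , λ { zero → ℕ.≤-refl ; (suc j) → ℕ.≤-trans f0≤ (min j) }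
  ... | inj₂ ≤f0 = suc i , λ { zero → ≤f0 ; (suc j) → min j }

  funToFin-cong : ∀ {m n} {f g : Fin m → Fin n} → (∀ i → f i ≡ g i) → funToFin f ≡ funToFin g
  funToFin-cong {zero}  eq = refl
  funToFin-cong {suc m} eq = cong₂ combine (eq zero) (funToFin-cong (eq ∘ suc))

  finToFun-injective : ∀ {m n} {a b : Fin (n ℕ.^ m)} →
                       (∀ i → finToFun {n} {m} a i ≡ finToFun b i) → a ≡ b
  finToFun-injective {m} {n} {a} {b} eq =
    trans (sym (Fin.funToFin-finToFin {m} a)) (trans (funToFin-cong eq) (Fin.funToFin-finToFin {m} b))

  remQuot-injective : ∀ {m} n {a b : Fin (m ℕ.* n)} → remQuot {m} n a ≡ remQuot n b → a ≡ b
  remQuot-injective {m} n {a} {b} eq =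
    trans (sym (Fin.combine-remQuot {m} n a)) (trans (cong (uncurry combine) eq) (Fin.combine-remQuot {m} n b))

  iterate : ∀ {a} {A : Set a} → (A → A) → ℕ → A → A
  iterate f zero    x = x
  iterate f (suc k) x = f (iterate f k x)

  -- Working on `Fin N` instead of the field provides an order, hence a canonical representative in
  -- each orbit, and propositional equality.
  module Orbits {N p} (pr : Prime p) (φ : Fin N → Fin N) (φᵖ≗id : ∀ x → iterate φ p x ≡ x) where

    private instance
      p≢0 : NonZero p
      p≢0 = prime⇒nonZero pr

    infixl 9 _·_
    _·_ : ℕ → Fin N → Fin N
    k · x = iterate φ k x

    Fixed : Fin N → Set
    Fixed x = φ x ≡ x

    ·-+ : ∀ j k x → (j ℕ.+ k) · x ≡ j · (k · x)
    ·-+ zero    k x = refl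
    ·-+ (suc j) k x = cong φ (·-+ j k x)

    ·-φ : ∀ k x → k · φ x ≡ φ (k · x)
    ·-φ zero    x = refl
    ·-φ (suc k) x = cong φ (·-φ k x)

    ·-periodic : ∀ {m x} → m · x ≡ x → ∀ q → (q ℕ.* m) · x ≡ x
    ·-periodic eq zero = refl
    ·-periodic {m} {x} eq (suc q) = trans (·-+ m (q ℕ.* m) x) (trans (cong (m ·_) (·-periodic eq q)) eq)

    ·-% : ∀ k x → k · x ≡ (k % p) · x
    ·-% k x = begin
      k · x                                ≡⟨ cong (_· x) (m≡m%n+[m/n]*n k p) ⟩
      (k % p ℕ.+ (k / p) ℕ.* p) · x        ≡⟨ ·-+ (k % p) ((k / p) ℕ.* p) x ⟩
      (k % p) · (((k / p) ℕ.* p) · x)      ≡⟨ cong ((k % p) ·_) (·-periodic (φᵖ≗id x) (k / p)) ⟩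
      (k % p) · x                          ∎
      where open ≡-Reasoning

    ·-inverse : ∀ {k} → k ℕ.≤ p → ∀ x → (p ℕ.∸ k) · (k · x) ≡ x
    ·-inverse {k} k≤p x = trans (sym (·-+ (p ℕ.∸ k) k x))
      (trans (cong (_· x) (ℕ.m∸n+n≡m k≤p)) (φᵖ≗id x))

    φ-injective : ∀ {x y} → φ x ≡ φ y → x ≡ y
    φ-injective {x} {y} eq = trans (sym (·-inverse 1≤p x))
      (trans (cong ((p ℕ.∸ 1) ·_) eq) (·-inverse 1≤p y))
      where
      1≤p : 1 ℕ.≤ p
      1≤p = ℕ.>-nonZero⁻¹ p

    ·-injective : ∀ k {x y} → k · x ≡ k · y → x ≡ y
    ·-injective zero    eq = eq
    ·-injective (suc k) eq = ·-injective k (φ-injective eq)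

    fixed-·⁻ : ∀ k {x} → Fixed (k · x) → Fixed x
    fixed-·⁻ k {x} eq = ·-injective k (trans (·-φ k x) eq)

    -- A period m coprime to p makes 1 a period.
    ·-free : ∀ {x m} → .{{NonZero m}} → m ℕ.< p → m · x ≡ x → Fixed x
    ·-free {x} {m} m<p eq with coprime-Bézout (prime⇒coprime pr m<p)
    ... | Bézout.+- a b e = one b m a p eq (φᵖ≗id x) e
      where
      one : ∀ b m a k → m · x ≡ x → k · x ≡ x → 1 ℕ.+ b ℕ.* m ≡ a ℕ.* k → Fixed x
      one b m a k mx kx e = trans (cong φ (sym (·-periodic mx b)))
        (trans (cong (_· x) e) (·-periodic kx a))
    ... | Bézout.-+ a b e = trans (cong φ (sym (·-periodic (φᵖ≗id x) a)))
        (trans (cong (_· x) e) (·-periodic eq b))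

    ·-distinct : ∀ {i j x} → ¬ Fixed x → i ℕ.< j → j ℕ.< p → i · x ≢ j · x
    ·-distinct {i} {j} {x} ¬fx i<j j<p eq = ¬fx
      (·-free {{ℕ.>-nonZero (ℕ.m<n⇒0<n∸m i<j)}} (ℕ.≤-<-trans (ℕ.m∸n≤m j i) j<p)
        (·-injective i (trans (sym (·-+ i (j ℕ.∸ i) x))
          (trans (cong (_· x) (ℕ.m+[n∸m]≡n (ℕ.<⇒≤ i<j))) (sym eq)))))

    ·-faithful : ∀ {x} → ¬ Fixed x → {i j : Fin p} → toℕ i · x ≡ toℕ j · x → i ≡ j
    ·-faithful ¬fx {i} {j} eq with ℕ.<-cmp (toℕ i) (toℕ j)
    ... | tri< i<j _ _ = contradiction eq (·-distinct ¬fx i<j (Fin.toℕ<n j))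
    ... | tri≈ _ i≡j _ = Fin.toℕ-injective i≡j
    ... | tri> _ _ j<i = contradiction (sym eq) (·-distinct ¬fx j<i (Fin.toℕ<n i))

    -- Every orbit is represented by its least element.
    Least : Fin N → Set
    Least x = ∀ (i : Fin p) → toℕ x ℕ.≤ toℕ (toℕ i · x)

    Representative : Fin N → Set
    Representative x = ¬ Fixed x × Least x

    representative? : Decidable Representative
    representative? x = ¬? (φ x Fin.≟ x) ×-dec Fin.all? (λ i → toℕ x ℕ.≤? toℕ (toℕ i · x))

    residue : ℕ → Fin p
    residue k = fromℕ< (m%n<n k p)

    ·-residue : ∀ k x → k · x ≡ toℕ (residue k) · x
    ·-residue k x = trans (·-% k x) (cong (_· x) (sym (Fin.toℕ-fromℕ< (m%n<n k p))))

    least-· : ∀ {x} → Least x → ∀ k → toℕ x ℕ.≤ toℕ (k · x)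
    least-· {x} least k = subst (λ y → toℕ x ℕ.≤ toℕ y) (sym (·-residue k x)) (least (residue k))

    transfer : ∀ {i : Fin p} {k x y} → toℕ i · x ≡ k · y → x ≡ ((p ℕ.∸ toℕ i) ℕ.+ k) · y
    transfer {i} {k} {x} {y} eq = trans (sym (·-inverse (Fin.toℕ≤n i) x))
      (trans (cong ((p ℕ.∸ toℕ i) ·_) eq) (sym (·-+ (p ℕ.∸ toℕ i) k y)))

    -- Each of x and y lies on the orbit of the other, so leastness gives both inequalities.
    least-unique : ∀ {x y} → Least x → Least y → {i j : Fin p} → toℕ i · x ≡ toℕ j · y → x ≡ y
    least-unique {x} {y} lx ly {i} {j} eq = Fin.toℕ-injective (ℕ.≤-antisym
      (subst (λ z → toℕ x ℕ.≤ toℕ z) (sym (transfer {j} (sym eq))) (least-· lx (p ℕ.∸ toℕ j ℕ.+ toℕ i)))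
      (subst (λ z → toℕ y ℕ.≤ toℕ z) (sym (transfer {i} eq)) (least-· ly (p ℕ.∸ toℕ i ℕ.+ toℕ j))))

    private enumeration = enumerate representative?

    M : ℕ
    M = proj₁ enumeration

    rep : Fin M → Fin N
    rep = proj₁ (proj₂ enumeration)

    rep-representative : ∀ j → Representative (rep j)
    rep-representative = proj₁ (proj₂ (proj₂ enumeration))

    orbit : Fin M × Fin p → Fin N
    orbit (j , i) = toℕ i · rep j

    orbit-¬fixed : ∀ s → ¬ Fixed (orbit s)
    orbit-¬fixed (j , i) = proj₁ (rep-representative j) ∘ fixed-·⁻ (toℕ i)

    orbit-injective : ∀ {s t} → orbit s ≡ orbit t → s ≡ t
    orbit-injective {j , i} {j′ , i′} eq with refl ← proj₁ (proj₂ (proj₂ (proj₂ enumeration)))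
      (least-unique (proj₂ (rep-representative j)) (proj₂ (rep-representative j′)) {i} {i′} eq) =
        cong (j ,_) (·-faithful (proj₁ (rep-representative j)) eq)

    orbit-surjective : ∀ {x} → ¬ Fixed x → ∃[ s ] orbit s ≡ x
    orbit-surjective {x} ¬fx with i , min ← argmin (λ (i : Fin p) → toℕ (toℕ i · x)) =
      -- The least point i · x of the orbit is a representative, and p - i further steps lead from
      -- it back to x.
      (proj₁ found , residue (p ℕ.∸ toℕ i)) ,
      trans (sym (·-residue (p ℕ.∸ toℕ i) _))
        (trans (cong ((p ℕ.∸ toℕ i) ·_) (proj₂ found)) (·-inverse (Fin.toℕ≤n i) x))
      where
      least : Least (toℕ i · x)
      least k = subst (λ y → toℕ (toℕ i · x) ℕ.≤ toℕ y)
        (trans (sym (·-residue (toℕ k ℕ.+ toℕ i) x)) (·-+ (toℕ k) (toℕ i) x))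
        (min (residue (toℕ k ℕ.+ toℕ i)))
      found = proj₂ (proj₂ (proj₂ (proj₂ enumeration))) (toℕ i · x) (¬fx ∘ fixed-·⁻ (toℕ i) , least)

    module Maps {Q} (fix : Fin Q → Fin N) (fix-fixed : ∀ i → Fixed (fix i))
      (fix-injective : ∀ {i j} → fix i ≡ fix j → i ≡ j)
      (fix-surjective : ∀ {x} → Fixed x → ∃[ i ] fix i ≡ x) where

      point : Fin Q ⊎ (Fin M × Fin p) → Fin N
      point = [ fix , orbit ]′

      point-injective : ∀ {s t} → point s ≡ point t → s ≡ t
      point-injective {inj₁ i} {inj₁ j} eq = cong inj₁ (fix-injective eq)
      point-injective {inj₁ i} {inj₂ t} eq = contradiction (subst Fixed eq (fix-fixed i)) (orbit-¬fixed t)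
      point-injective {inj₂ s} {inj₁ j} eq = contradiction (subst Fixed (sym eq) (fix-fixed j)) (orbit-¬fixed s)
      point-injective {inj₂ s} {inj₂ t} eq = cong inj₂ (orbit-injective eq)

      point-surjective : ∀ x → ∃[ s ] point s ≡ x
      point-surjective x with φ x Fin.≟ x
      ... | yes fx = let i , eq = fix-surjective fx in inj₁ i , eq
      ... | no ¬fx = let s , eq = orbit-surjective ¬fx in inj₂ s , eq

      locate : Fin N → Fin Q ⊎ (Fin M × Fin p)
      locate x = proj₁ (point-surjective x)

      point-locate : ∀ x → point (locate x) ≡ x
      point-locate x = proj₂ (point-surjective x)

      locate-point : ∀ s → locate (point s) ≡ s
      locate-point s = point-injective (point-locate (point s))

      -- With N = pᵖ and Q = p, this is the equation that determines M.
      N≡Q+Mp : N ≡ Q ℕ.+ M ℕ.* p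
      N≡Q+Mp = ↔⇒≡ (↔-trans (mk↔ₛ′ locate point locate-point point-locate)
        (↔-trans (↔-refl ⊎-↔ ↔-sym Fin.*↔×) (↔-sym Fin.+↔⊎)))

      -- Numbering the non-fixed points by one `Fin (M ℕ.* p)` makes the free choices functions
      -- between finite ordinals, which `funToFin` can encode.
      cell : Fin (M ℕ.* p) → Fin N
      cell = orbit ∘ remQuot p

      extend : (Fin Q → Fin Q) → (Fin M → Fin (M ℕ.* p)) → Fin N → Fin N
      extend u v x with locate x
      ... | inj₁ i       = fix (u i)
      ... | inj₂ (j , i) = toℕ i · cell (v j)

      module _ (u : Fin Q → Fin Q) (v : Fin M → Fin (M ℕ.* p)) where

        extend-fix : ∀ i → extend u v (fix i) ≡ fix (u i)
        extend-fix i rewrite locate-point (inj₁ i) = refl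

        extend-orbit : ∀ j i → extend u v (orbit (j , i)) ≡ toℕ i · cell (v j)
        extend-orbit j i rewrite locate-point (inj₂ (j , i)) = refl

        -- `extend` is defined by exponents below p, but φ takes exponent p - 1 to p; equivariance
        -- therefore needs the formula for every k.
        extend-· : ∀ k j → extend u v (k · rep j) ≡ k · cell (v j)
        extend-· k j = begin
          extend u v (k · rep j)               ≡⟨ cong (extend u v) (·-residue k (rep j)) ⟩
          extend u v (orbit (j , residue k))   ≡⟨ extend-orbit j (residue k) ⟩
          toℕ (residue k) · cell (v j)         ≡⟨ ·-residue k (cell (v j)) ⟨
          k · cell (v j)                       ∎
          where open ≡-Reasoning

        extend-equivariant : ∀ x → extend u v (φ x) ≡ φ (extend u v x)
        extend-equivariant x with point-surjective x
        ... | inj₁ i , refl = begin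
          extend u v (φ (fix i))   ≡⟨ cong (extend u v) (fix-fixed i) ⟩
          extend u v (fix i)       ≡⟨ extend-fix i ⟩
          fix (u i)                ≡⟨ fix-fixed (u i) ⟨
          φ (fix (u i))            ∎
          where open ≡-Reasoning
        ... | inj₂ (j , i) , refl = extend-· (suc (toℕ i)) j

        extend-preserving : ∀ x → ¬ Fixed x → ¬ Fixed (extend u v x)
        extend-preserving x ¬fx with point-surjective x
        ... | inj₁ i , refl       = contradiction (fix-fixed i) ¬fx
        ... | inj₂ (j , i) , refl = orbit-¬fixed (remQuot p (v j)) ∘ fixed-·⁻ (toℕ i)

      extend-unique : ∀ {u v} {g : Fin N → Fin N} → (∀ x → g (φ x) ≡ φ (g x)) →
        (∀ i → g (fix i) ≡ fix (u i)) → (∀ j → g (rep j) ≡ cell (v j)) →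
        ∀ x → extend u v x ≡ g x
      extend-unique {u} {v} {g} equivariant on-fix on-rep x with point-surjective x
      ... | inj₁ i , refl       = sym (on-fix i)
      ... | inj₂ (j , i) , refl = trans (cong (toℕ i ·_) (sym (on-rep j))) (sym (go (toℕ i)))
        where
        go : ∀ k → g (k · rep j) ≡ k · g (rep j)
        go zero    = refl
        go (suc k) = trans (equivariant _) (cong φ (go k))

      count : ℕ
      count = Q ℕ.^ Q ℕ.* (M ℕ.* p) ℕ.^ M

      module _ (c : Fin count) where

        fixedPart : Fin Q → Fin Q
        fixedPart = finToFun (proj₁ (remQuot {Q ℕ.^ Q} ((M ℕ.* p) ℕ.^ M) c))

        freePart : Fin M → Fin (M ℕ.* p)
        freePart = finToFun (proj₂ (remQuot {Q ℕ.^ Q} ((M ℕ.* p) ℕ.^ M) c))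

        decode : Fin N → Fin N
        decode = extend fixedPart freePart

      cell-injective : ∀ {a b} → cell a ≡ cell b → a ≡ b
      cell-injective = remQuot-injective {M} p ∘ orbit-injective

      decode-injective : ∀ {c d} → (∀ x → decode c x ≡ decode d x) → c ≡ d
      decode-injective {c} {d} eq = remQuot-injective {Q ℕ.^ Q} _ (cong₂ _,_
        (finToFun-injective {Q} {Q} λ i → fix-injective (begin
          fix (fixedPart c i)   ≡⟨ extend-fix _ _ i ⟨
          decode c (fix i)      ≡⟨ eq (fix i) ⟩
          decode d (fix i)      ≡⟨ extend-fix _ _ i ⟩
          fix (fixedPart d i)   ∎))
        (finToFun-injective {M} λ j → cell-injective (begin
          cell (freePart c j)   ≡⟨ extend-· _ _ 0 j ⟨
          decode c (rep j)      ≡⟨ eq (rep j) ⟩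
          decode d (rep j)      ≡⟨ extend-· _ _ 0 j ⟩
          cell (freePart d j)   ∎)))
        where open ≡-Reasoning

      module Encode {g : Fin N → Fin N} (equivariant : ∀ x → g (φ x) ≡ φ (g x))
        (preserving : ∀ x → ¬ Fixed x → ¬ Fixed (g x)) where

        private
          u : ∀ i → ∃[ k ] fix k ≡ g (fix i)
          u i = fix-surjective (trans (sym (equivariant (fix i))) (cong g (fix-fixed i)))

          v : ∀ j → ∃[ s ] orbit s ≡ g (rep j)
          v j = orbit-surjective (preserving (rep j) (proj₁ (rep-representative j)))

          v′ : Fin M → Fin (M ℕ.* p)
          v′ j = uncurry combine (proj₁ (v j))

        encode : Fin count
        encode = combine (funToFin (proj₁ ∘ u)) (funToFin v′)

        decode-encode : ∀ x → decode encode x ≡ g x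
        decode-encode = extend-unique equivariant
          (λ i → trans (sym (proj₂ (u i))) (cong fix (sym (on-fix i))))
          (λ j → trans (sym (proj₂ (v j))) (cong orbit (sym (on-rep j))))
          where
          rq = Fin.remQuot-combine (funToFin (proj₁ ∘ u)) (funToFin v′)
          on-fix : ∀ i → fixedPart encode i ≡ proj₁ (u i)
          on-fix i = trans (cong (λ r → finToFun (proj₁ r) i) rq) (Fin.finToFun-funToFin (proj₁ ∘ u) i)
          on-rep : ∀ j → remQuot p (freePart encode j) ≡ proj₁ (v j)
          on-rep j = trans (cong (remQuot p) (trans (cong (λ r → finToFun (proj₂ r) j) rq) (Fin.finToFun-funToFin v′ j)))
            (Fin.remQuot-combine (proj₁ (proj₁ (v j))) _)

-- Bounds for (1 − 1/(m + 1))ᵐ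

module ExponentialBounds where

  open import Data.Integer.Base as ℤ using (+_)
  import Data.Integer.Properties as ℤ
  open import Data.Rational.Base as ℚ using (ℚ; 0ℚ; 1ℚ; ½; _+_; _*_; -_; _-_; _≤_; _<_; ∣_∣; _/_)
  import Data.Rational.Properties as ℚ
  open import Data.Rational.Solver using (module +-*-Solver)
  import Data.Rational.Unnormalised.Base as ℚᵘ
  import Data.Rational.Unnormalised.Properties as ℚᵘ
  open import Relation.Binary.PropositionalEquality

  private
    module R = CommutativeRing ℚ.+-*-commutativeRing
  open SemiringExp R.commutativeSemiring using (_^_; ^-distrib-*)
  open SemiringMult R.semiring using (×1-homo-*) renaming (_×_ to _×ℚ_)
  open +-*-Solver using (solve; _:=_; _:+_; _:-_; _:*_; con)

  -- The embedding of ℕ in ℚ by repeated addition of 1: `κ (suc n)` unfolds to `1ℚ + κ n`, and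
  -- multiplicativity comes from the semiring laws.
  κ : ℕ → ℚ
  κ n = n ×ℚ 1ℚ

  κ≡/1 : ∀ n → κ n ≡ + n / 1
  κ≡/1 zero    = refl
  κ≡/1 (suc n) = trans (cong (λ q → 1ℚ + q) (κ≡/1 n)) (ℚ.toℚᵘ-injective (begin
    ℚ.toℚᵘ (1ℚ + + n / 1)                 ≈⟨ ℚ.toℚᵘ-homo-+ 1ℚ (+ n / 1) ⟩
    ℚ.toℚᵘ 1ℚ ℚᵘ.+ ℚ.toℚᵘ (+ n / 1)       ≈⟨ ℚᵘ.+-congʳ (ℚ.toℚᵘ 1ℚ) (ℚ.toℚᵘ-fromℚᵘ (ℚᵘ.mkℚᵘ (+ n) 0)) ⟩
    ℚ.toℚᵘ 1ℚ ℚᵘ.+ ℚᵘ.mkℚᵘ (+ n) 0        ≈⟨ ℚᵘ.*≡* (cong (ℤ._* + 1) (cong (λ i → ℤ.1ℤ ℤ.+ i) (ℤ.*-identityʳ (+ n)))) ⟩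
    ℚᵘ.mkℚᵘ (+ suc n) 0                   ≈⟨ ℚ.toℚᵘ-fromℚᵘ (ℚᵘ.mkℚᵘ (+ suc n) 0) ⟨
    ℚ.toℚᵘ (+ suc n / 1)                  ∎))
    where open ℚᵘ.≃-Reasoning

  -- Characterises a / d without reference to its normal form; later identities of fractions are
  -- reduced to this one by clearing denominators.
  /-*-κ : ∀ a d .{{_ : NonZero d}} → (+ a / d) * κ d ≡ κ a
  /-*-κ a d@(suc d-1) = trans (cong ((+ a / d) *_) (κ≡/1 d)) (trans (ℚ.toℚᵘ-injective (begin
    ℚ.toℚᵘ ((+ a / d) * (+ d / 1))                    ≈⟨ ℚ.toℚᵘ-homo-* (+ a / d) (+ d / 1) ⟩
    ℚ.toℚᵘ (+ a / d) ℚᵘ.* ℚ.toℚᵘ (+ d / 1)            ≈⟨ ℚᵘ.*-cong (ℚ.toℚᵘ-fromℚᵘ (ℚᵘ.mkℚᵘ (+ a) d-1)) (ℚ.toℚᵘ-fromℚᵘ (ℚᵘ.mkℚᵘ (+ d) 0)) ⟩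
    ℚᵘ.mkℚᵘ (+ a) d-1 ℚᵘ.* ℚᵘ.mkℚᵘ (+ d) 0            ≈⟨ ℚᵘ.*≡* (trans (ℤ.*-identityʳ _) (cong (λ k → + a ℤ.* + k) (sym (ℕ.*-identityʳ d)))) ⟩
    ℚᵘ.mkℚᵘ (+ a) 0                                   ≈⟨ ℚ.toℚᵘ-fromℚᵘ (ℚᵘ.mkℚᵘ (+ a) 0) ⟨
    ℚ.toℚᵘ (+ a / 1)                                  ∎)) (sym (κ≡/1 a)))
    where open ℚᵘ.≃-Reasoning

  κ-* : ∀ m n → κ (m ℕ.* n) ≡ κ m * κ n
  κ-* = ×1-homo-*

  κ-^ : ∀ m n → κ (m ℕ.^ n) ≡ κ m ^ n
  κ-^ m zero    = refl
  κ-^ m (suc n) = trans (κ-* m (m ℕ.^ n)) (cong (κ m *_) (κ-^ m n))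

  0≤1 : 0ℚ ≤ 1ℚ
  0≤1 = ℚ.nonNegative⁻¹ 1ℚ

  0<1 : 0ℚ < 1ℚ
  0<1 = ℚ.positive⁻¹ 1ℚ

  *-monoˡ : ∀ {p q r} → 0ℚ ≤ r → p ≤ q → p * r ≤ q * r
  *-monoˡ {r = r} 0≤r = ℚ.*-monoʳ-≤-nonNeg r {{ℚ.nonNegative 0≤r}}

  *-monoʳ : ∀ {p q r} → 0ℚ ≤ r → p ≤ q → r * p ≤ r * q
  *-monoʳ {r = r} 0≤r = ℚ.*-monoˡ-≤-nonNeg r {{ℚ.nonNegative 0≤r}}

  0≤* : ∀ {p q} → 0ℚ ≤ p → 0ℚ ≤ q → 0ℚ ≤ p * q
  0≤* {p} {q} 0≤p 0≤q = subst (_≤ p * q) (ℚ.*-zeroˡ q) (*-monoˡ 0≤q 0≤p)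

  0≤^ : ∀ {p} n → 0ℚ ≤ p → 0ℚ ≤ p ^ n
  0≤^ zero    0≤p = 0≤1
  0≤^ (suc n) 0≤p = 0≤* 0≤p (0≤^ n 0≤p)

  p≤p+q : ∀ {p q} → 0ℚ ≤ q → p ≤ p + q
  p≤p+q {p} {q} 0≤q = subst (_≤ p + q) (ℚ.+-identityʳ p) (ℚ.+-monoʳ-≤ p 0≤q)

  κ-mono : ∀ {m n} → m ℕ.≤ n → κ m ≤ κ n
  κ-mono {n = zero}  z≤n     = ℚ.≤-refl
  κ-mono {n = suc n} z≤n     = ℚ.≤-trans (κ-mono {n = n} z≤n)
    (subst (_≤ 1ℚ + κ n) (ℚ.+-identityˡ (κ n)) (ℚ.+-monoˡ-≤ (κ n) 0≤1))
  κ-mono (s≤s m≤n) = ℚ.+-monoʳ-≤ 1ℚ (κ-mono m≤n)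

  0≤κ : ∀ n → 0ℚ ≤ κ n
  0≤κ n = κ-mono {0} {n} z≤n

  inverse-unique : ∀ {x u v} → u * x ≡ 1ℚ → v * x ≡ 1ℚ → u ≡ v
  inverse-unique {x} {u} {v} ux≡1 vx≡1 = begin
    u            ≡⟨ ℚ.*-identityʳ u ⟨
    u * 1ℚ       ≡⟨ cong (u *_) vx≡1 ⟨
    u * (v * x)  ≡⟨ solve 3 (λ u v x → u :* (v :* x) := v :* (u :* x)) refl u v x ⟩
    v * (u * x)  ≡⟨ cong (v *_) ux≡1 ⟩
    v * 1ℚ       ≡⟨ ℚ.*-identityʳ v ⟩
    v            ∎
    where open ≡-Reasoning

  1^ : ∀ n → 1ℚ ^ n ≡ 1ℚ
  1^ zero    = refl
  1^ (suc n) = trans (ℚ.*-identityˡ _) (1^ n)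

  ^-inverse : ∀ {x y} n → x * y ≡ 1ℚ → x ^ n * y ^ n ≡ 1ℚ
  ^-inverse {x} {y} n xy≡1 = trans (sym (^-distrib-* x y n)) (trans (cong (_^ n) xy≡1) (1^ n))

  κ-cancel : ∀ {x y} d .{{_ : NonZero d}} → x * κ d ≡ y * κ d → x ≡ y
  κ-cancel {x} {y} d eq = trans (sym (lem x)) (trans (cong (_* (+ 1 / d)) eq) (lem y))
    where
    lem : ∀ x → x * κ d * (+ 1 / d) ≡ x
    lem x = trans (solve 3 (λ x k i → x :* k :* i := x :* (i :* k)) refl x (κ d) (+ 1 / d))
      (trans (cong (x *_) (/-*-κ 1 d)) (ℚ.*-identityʳ x))

  0≤1/ : ∀ n .{{_ : NonZero n}} → 0ℚ ≤ + 1 / n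
  0≤1/ n = ℚ.nonNegative⁻¹ _ {{ℚ.normalize-nonNeg 1 n}}

  0≤invFact : ∀ k → 0ℚ ≤ invFact k
  0≤invFact k = 0≤1/ (k !) {{k ℕ.!≢0}}

  invFact-*κ! : ∀ k → invFact k * κ (k !) ≡ 1ℚ
  invFact-*κ! k = /-*-κ 1 (k !) {{k ℕ.!≢0}}

  invFact-suc : ∀ k → invFact k ≡ κ (suc k) * invFact (suc k)
  invFact-suc k = inverse-unique (invFact-*κ! k) (begin
    κ (suc k) * invFact (suc k) * κ (k !)    ≡⟨ solve 3 (λ a b c → a :* b :* c := b :* (a :* c)) refl (κ (suc k)) (invFact (suc k)) (κ (k !)) ⟩
    invFact (suc k) * (κ (suc k) * κ (k !))  ≡⟨ cong (invFact (suc k) *_) (κ-* (suc k) (k !)) ⟨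
    invFact (suc k) * κ (suc k !)            ≡⟨ invFact-*κ! (suc k) ⟩
    1ℚ                                       ∎)
    where open ≡-Reasoning

  -- The Taylor polynomial of exp with k terms, hence of degree k - 1.
  expSum : ℕ → ℚ → ℚ
  expSum zero    y = 0ℚ
  expSum (suc k) y = expSum k y + y ^ k * invFact k

  expSum-1 : ∀ k → expSum k 1ℚ ≡ expPartialSum k
  expSum-1 zero    = refl
  expSum-1 (suc k) = cong₂ _+_ (expSum-1 k) (trans (cong (_* invFact k) (1^ k)) (ℚ.*-identityˡ _))

  expSum-0 : ∀ k → expSum (suc k) 0ℚ ≡ 1ℚ
  expSum-0 zero    = refl
  expSum-0 (suc k) = cong₂ _+_ (expSum-0 k)
    (trans (cong (_* invFact (suc k)) (ℚ.*-zeroˡ (0ℚ ^ k))) (ℚ.*-zeroˡ (invFact (suc k))))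

  0≤term : ∀ {y} k → 0ℚ ≤ y → 0ℚ ≤ y ^ k * invFact k
  0≤term k 0≤y = 0≤* (0≤^ k 0≤y) (0≤invFact k)

  expSum-suc : ∀ {y} k → 0ℚ ≤ y → expSum k y ≤ expSum (suc k) y
  expSum-suc k 0≤y = p≤p+q (0≤term k 0≤y)

  expSum-mono : ∀ {y m n} → 0ℚ ≤ y → m ℕ.≤′ n → expSum m y ≤ expSum n y
  expSum-mono 0≤y ℕ.≤′-refl = ℚ.≤-refl
  expSum-mono 0≤y (ℕ.≤′-step {n} l) = ℚ.≤-trans (expSum-mono 0≤y l) (expSum-suc n 0≤y)

  module _ {y t} (0≤y : 0ℚ ≤ y) (0≤t : 0ℚ ≤ t) where

    private
      z = y + t

      0≤z : 0ℚ ≤ z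
      0≤z = ℚ.≤-trans 0≤y (p≤p+q 0≤t)

      y≤z : y ≤ z
      y≤z = p≤p+q 0≤t

      ^-mono : ∀ k → y ^ k ≤ z ^ k
      ^-mono zero    = ℚ.≤-refl
      ^-mono (suc k) = ℚ.≤-trans (*-monoˡ (0≤^ k 0≤y) y≤z) (*-monoʳ 0≤z (^-mono k))

    -- The mean value bound for the (k + 1)-st power, with the derivative taken at the right end z.
    -- The inductive step leaves t yᵏ⁺¹, which is enlarged to t zᵏ⁺¹.
    ^-increment-≤ : ∀ k → z ^ suc k ≤ y ^ suc k + κ (suc k) * (t * z ^ k)
    ^-increment-≤ zero    = ℚ.≤-reflexive (solve 2 (λ y t → (y :+ t) :* con 1ℚ := y :* con 1ℚ :+ con 1ℚ :* (t :* con 1ℚ)) refl y t)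
    ^-increment-≤ (suc k) = begin
      z * z ^ suc k                                             ≤⟨ *-monoʳ 0≤z (^-increment-≤ k) ⟩
      z * (y ^ suc k + κ (suc k) * (t * z ^ k))                 ≡⟨ solve 5 (λ y t Y K Z → (y :+ t) :* (Y :+ K :* (t :* Z)) := t :* Y :+ (y :* Y :+ K :* (t :* ((y :+ t) :* Z)))) refl y t (y ^ suc k) (κ (suc k)) (z ^ k) ⟩
      t * y ^ suc k + (y * y ^ suc k + κ (suc k) * (t * z ^ suc k)) ≤⟨ ℚ.+-monoˡ-≤ _ (*-monoʳ 0≤t (^-mono (suc k))) ⟩
      t * z ^ suc k + (y * y ^ suc k + κ (suc k) * (t * z ^ suc k)) ≡⟨ solve 3 (λ a b c → a :+ (b :+ c :* a) := b :+ (con 1ℚ :+ c) :* a) refl (t * z ^ suc k) (y * y ^ suc k) (κ (suc k)) ⟩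
      y * y ^ suc k + κ (suc (suc k)) * (t * z ^ suc k)         ∎
      where open ℚ.≤-Reasoning

    ^-increment-≥ : ∀ k → y ^ suc k + κ (suc k) * (t * y ^ k) ≤ z ^ suc k
    ^-increment-≥ zero    = ℚ.≤-reflexive (solve 2 (λ y t → y :* con 1ℚ :+ con 1ℚ :* (t :* con 1ℚ) := (y :+ t) :* con 1ℚ) refl y t)
    ^-increment-≥ (suc k) = begin
      y * y ^ suc k + κ (suc (suc k)) * (t * y ^ suc k)         ≡⟨ solve 4 (λ y t K W → y :* (y :* W) :+ (con 1ℚ :+ K) :* (t :* (y :* W)) := y :* (y :* W :+ K :* (t :* W)) :+ t :* (y :* W)) refl y t (κ (suc k)) (y ^ k) ⟩
      y * (y ^ suc k + κ (suc k) * (t * y ^ k)) + t * y ^ suc k ≤⟨ ℚ.+-mono-≤ (*-monoʳ 0≤y (^-increment-≥ k)) (*-monoʳ 0≤t (^-mono (suc k))) ⟩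
      y * z ^ suc k + t * z ^ suc k                             ≡⟨ ℚ.*-distribʳ-+ (z ^ suc k) y t ⟨
      z * z ^ suc k                                             ∎
      where open ℚ.≤-Reasoning

    private
      -- Termwise differentiation: the factor k + 1 from the power rule turns 1/(k + 1)! into 1/k!,
      -- so the terms of exp reappear one place lower.
      regroup : ∀ k w → κ (suc k) * (t * w) * invFact (suc k) ≡ t * (w * invFact k)
      regroup k w = trans
        (solve 4 (λ K t w i → K :* (t :* w) :* i := t :* (w :* (K :* i))) refl (κ (suc k)) t w (invFact (suc k)))
        (cong (λ i → t * (w * i)) (sym (invFact-suc k)))

      shuffle : ∀ a b t c d → (a + t * b) + (c + t * d) ≡ (a + c) + t * (b + d)
      shuffle = solve 5 (λ a b t c d → (a :+ t :* b) :+ (c :+ t :* d) := (a :+ c) :+ t :* (b :+ d)) refl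

    -- The mean value bounds for exp, whose derivative is exp; truncation loses one term.
    expSum-increment-≤ : ∀ k → expSum (suc k) z ≤ expSum (suc k) y + t * expSum k z
    expSum-increment-≤ zero    = p≤p+q (ℚ.≤-reflexive (sym (ℚ.*-zeroʳ t)))
    expSum-increment-≤ (suc k) = begin
      expSum (suc k) z + z ^ suc k * i
        ≤⟨ ℚ.+-mono-≤ (expSum-increment-≤ k) (*-monoˡ (0≤invFact (suc k)) (^-increment-≤ k)) ⟩
      (expSum (suc k) y + t * expSum k z) + (y ^ suc k + κ (suc k) * (t * z ^ k)) * i
        ≡⟨ cong (λ r → (expSum (suc k) y + t * expSum k z) + r) (trans (ℚ.*-distribʳ-+ i (y ^ suc k) (κ (suc k) * (t * z ^ k))) (cong (λ r → y ^ suc k * i + r) (regroup k (z ^ k)))) ⟩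
      (expSum (suc k) y + t * expSum k z) + (y ^ suc k * i + t * (z ^ k * invFact k))
        ≡⟨ shuffle (expSum (suc k) y) (expSum k z) t _ _ ⟩
      expSum (suc (suc k)) y + t * expSum (suc k) z ∎
      where
      open ℚ.≤-Reasoning
      i = invFact (suc k)

    expSum-increment-≥ : ∀ k → expSum (suc k) y + t * expSum k y ≤ expSum (suc k) z
    expSum-increment-≥ zero    = ℚ.≤-reflexive (trans (cong (λ r → expSum 1 y + r) (ℚ.*-zeroʳ t)) (ℚ.+-identityʳ _))
    expSum-increment-≥ (suc k) = begin
      expSum (suc (suc k)) y + t * expSum (suc k) y
        ≡⟨ shuffle (expSum (suc k) y) (expSum k y) t _ _ ⟨
      (expSum (suc k) y + t * expSum k y) + (y ^ suc k * i + t * (y ^ k * invFact k))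
        ≡⟨ cong (λ r → (expSum (suc k) y + t * expSum k y) + r) (trans (ℚ.*-distribʳ-+ i (y ^ suc k) (κ (suc k) * (t * y ^ k))) (cong (λ r → y ^ suc k * i + r) (regroup k (y ^ k)))) ⟨
      (expSum (suc k) y + t * expSum k y) + (y ^ suc k + κ (suc k) * (t * y ^ k)) * i
        ≤⟨ ℚ.+-mono-≤ (expSum-increment-≥ k) (*-monoˡ (0≤invFact (suc k)) (^-increment-≥ k)) ⟩
      expSum (suc (suc k)) z ∎
      where
      open ℚ.≤-Reasoning
      i = invFact (suc k)

  κ-suc-* : ∀ n t → κ (suc n) * t ≡ κ n * t + t
  κ-suc-* n t = solve 2 (λ k t → (con 1ℚ :+ k) :* t := k :* t :+ t) refl (κ n) t

  -- Each factor contributes (1 - t) exp(y + t) ≤ exp y. The number of terms stays fixed, because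
  -- the term lost by truncation is nonnegative and may be added back.
  [1-t]^n*expSum≤1 : ∀ {t} → 0ℚ ≤ t → t ≤ 1ℚ → ∀ k n → (1ℚ - t) ^ n * expSum (suc k) (κ n * t) ≤ 1ℚ
  [1-t]^n*expSum≤1 {t} 0≤t t≤1 k zero = ℚ.≤-reflexive
    (trans (ℚ.*-identityˡ _) (trans (cong (expSum (suc k)) (ℚ.*-zeroˡ t)) (expSum-0 k)))
  [1-t]^n*expSum≤1 {t} 0≤t t≤1 k (suc n) = begin
    (1ℚ - t) * (1ℚ - t) ^ n * expSum (suc k) (κ (suc n) * t)   ≡⟨ cong (λ y → (1ℚ - t) * (1ℚ - t) ^ n * expSum (suc k) y) (κ-suc-* n t) ⟩
    (1ℚ - t) * (1ℚ - t) ^ n * E                                ≡⟨ solve 3 (λ a b e → a :* b :* e := b :* (a :* e)) refl (1ℚ - t) ((1ℚ - t) ^ n) E ⟩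
    (1ℚ - t) ^ n * ((1ℚ - t) * E)                              ≤⟨ *-monoʳ (0≤^ n 0≤1-t) step ⟩
    (1ℚ - t) ^ n * expSum (suc k) (κ n * t)                    ≤⟨ [1-t]^n*expSum≤1 0≤t t≤1 k n ⟩
    1ℚ                                                         ∎
    where
    open ℚ.≤-Reasoning
    E = expSum (suc k) (κ n * t + t)
    0≤1-t : 0ℚ ≤ 1ℚ - t
    0≤1-t = subst (_≤ 1ℚ - t) (ℚ.+-inverseʳ t) (ℚ.+-monoˡ-≤ (- t) t≤1)
    0≤nt : 0ℚ ≤ κ n * t
    0≤nt = 0≤* (0≤κ n) 0≤t
    step : (1ℚ - t) * E ≤ expSum (suc k) (κ n * t)
    step = begin
      (1ℚ - t) * E                                   ≡⟨ solve 2 (λ t e → (con 1ℚ :- t) :* e := e :- t :* e) refl t E ⟩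
      E - t * E                                      ≤⟨ ℚ.+-monoˡ-≤ (- (t * E)) (expSum-increment-≤ 0≤nt 0≤t k) ⟩
      expSum (suc k) (κ n * t) + t * expSum k (κ n * t + t) - t * E
                                                     ≤⟨ ℚ.+-monoˡ-≤ (- (t * E)) (ℚ.+-monoʳ-≤ (expSum (suc k) (κ n * t)) (*-monoʳ 0≤t (expSum-suc k (ℚ.≤-trans 0≤nt (p≤p+q 0≤t))))) ⟩
      expSum (suc k) (κ n * t) + t * E - t * E       ≡⟨ solve 2 (λ a b → a :+ b :- b := a) refl (expSum (suc k) (κ n * t)) (t * E) ⟩
      expSum (suc k) (κ n * t)                       ∎

  -- Each factor contributes (1 + s) exp y ≤ exp(y + s). Here truncation works against the bound, so
  -- every factor costs one more term and n factors need n + 1 terms.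
  [1+s]^n≤expSum : ∀ {s} → 0ℚ ≤ s → ∀ n → (1ℚ + s) ^ n ≤ expSum (suc n) (κ n * s)
  [1+s]^n≤expSum {s} 0≤s zero    = ℚ.≤-refl
  [1+s]^n≤expSum {s} 0≤s (suc n) = begin
    (1ℚ + s) * (1ℚ + s) ^ n                            ≤⟨ *-monoʳ (ℚ.≤-trans 0≤1 (p≤p+q 0≤s)) ([1+s]^n≤expSum 0≤s n) ⟩
    (1ℚ + s) * expSum (suc n) y                        ≡⟨ solve 2 (λ s e → (con 1ℚ :+ s) :* e := e :+ s :* e) refl s (expSum (suc n) y) ⟩
    expSum (suc n) y + s * expSum (suc n) y            ≤⟨ ℚ.+-monoˡ-≤ (s * expSum (suc n) y) (expSum-suc (suc n) 0≤y) ⟩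
    expSum (suc (suc n)) y + s * expSum (suc n) y      ≤⟨ expSum-increment-≥ 0≤y 0≤s (suc n) ⟩
    expSum (suc (suc n)) (y + s)                       ≡⟨ cong (expSum (suc (suc n))) (κ-suc-* n s) ⟨
    expSum (suc (suc n)) (κ (suc n) * s)               ∎
    where
    open ℚ.≤-Reasoning
    y = κ n * s
    0≤y : 0ℚ ≤ y
    0≤y = 0≤* (0≤κ n) 0≤s

  -- With t = 1/(m+1), the number (1 − t)ᵐ e lies between 1 and 1/(1 − t).
  module _ (m : ℕ) .{{_ : NonZero m}} where

    private
      n = suc m
      t s a : ℚ
      t = + 1 / n
      -- Chosen so that 1 + s is the inverse of 1 - t.
      s = + 1 / m
      a = (1ℚ - t) ^ m

      nt≡1 : κ n * t ≡ 1ℚ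
      nt≡1 = trans (ℚ.*-comm (κ n) t) (/-*-κ 1 n)

      ms≡1 : κ m * s ≡ 1ℚ
      ms≡1 = trans (ℚ.*-comm (κ m) s) (/-*-κ 1 m)

      0≤t : 0ℚ ≤ t
      0≤t = 0≤1/ n

      0≤s : 0ℚ ≤ s
      0≤s = 0≤1/ m

      1-t≡mt : 1ℚ - t ≡ κ m * t
      1-t≡mt = trans (cong (_- t) (trans (sym nt≡1) (κ-suc-* m t)))
        (solve 2 (λ a t → a :+ t :- t := a) refl (κ m * t) t)

      0≤1-t : 0ℚ ≤ 1ℚ - t
      0≤1-t = subst (0ℚ ≤_) (sym 1-t≡mt) (0≤* (0≤κ m) 0≤t)

      1-t≤1 : 1ℚ - t ≤ 1ℚ
      1-t≤1 = subst (1ℚ - t ≤_) (solve 1 (λ t → con 1ℚ :- t :+ t := con 1ℚ) refl t) (p≤p+q 0≤t)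

      t≤1 : t ≤ 1ℚ
      t≤1 = subst (t ≤_) (solve 1 (λ t → t :+ (con 1ℚ :- t) := con 1ℚ) refl t) (p≤p+q 0≤1-t)

      a≤1 : ∀ k → (1ℚ - t) ^ k ≤ 1ℚ
      a≤1 zero    = ℚ.≤-refl
      a≤1 (suc k) = ℚ.≤-trans (*-monoˡ (0≤^ k 0≤1-t) 1-t≤1)
        (ℚ.≤-trans (ℚ.≤-reflexive (ℚ.*-identityˡ _)) (a≤1 k))

      [1-t][1+s]≡1 : (1ℚ - t) * (1ℚ + s) ≡ 1ℚ
      [1-t][1+s]≡1 = begin
        (1ℚ - t) * (1ℚ + s)               ≡⟨ cong (_* (1ℚ + s)) 1-t≡mt ⟩
        κ m * t * (1ℚ + s)                ≡⟨ solve 3 (λ k t s → k :* t :* (con 1ℚ :+ s) := t :* (k :+ k :* s)) refl (κ m) t s ⟩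
        t * (κ m + κ m * s)               ≡⟨ cong (λ r → t * (κ m + r)) ms≡1 ⟩
        t * (κ m + 1ℚ)                    ≡⟨ solve 2 (λ k t → t :* (k :+ con 1ℚ) := (con 1ℚ :+ k) :* t) refl (κ m) t ⟩
        κ n * t                           ≡⟨ nt≡1 ⟩
        1ℚ                                ∎
        where open ≡-Reasoning

    -- The bound for (1 + s)ᵐ produces a sum of m + 1 = n terms, hence the condition on k.
    module _ {k} (n≤k : n ℕ.≤ k) where

      private
        S r : ℚ
        S = expPartialSum k
        -- The k-th term of `reciprocal e 0<e`, whose cut-off δ is 1; as S ≥ 1, the cut-off has no
        -- effect and r = 1/S.
        r = Reciprocal.recip 1ℚ 0<1 S

        1≤S : 1ℚ ≤ S
        1≤S = subst (1ℚ ≤_) (expSum-1 k) (expSum-mono {1ℚ} {1} 0≤1 (ℕ.≤⇒≤′ (ℕ.≤-trans (s≤s z≤n) n≤k)))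

        Sr≡1 : S * r ≡ 1ℚ
        Sr≡1 = trans (cong (_* r) (sym (ℚ.p≤q⇒p⊔q≡q 1≤S))) (Reciprocal.*-recip 1ℚ 0<1 S)

        0≤r : 0ℚ ≤ r
        0≤r = ℚ.<⇒≤ (ℚ.positive⁻¹ r {{Reciprocal.recip-pos 1ℚ 0<1 S}})

        divide : ∀ {p q} → p ≤ q * S → p * r ≤ q
        divide {p} {q} p≤qS = ℚ.≤-trans (*-monoˡ 0≤r p≤qS) (ℚ.≤-reflexive
          (trans (ℚ.*-assoc q S r) (trans (cong (q *_) Sr≡1) (ℚ.*-identityʳ q))))

        multiply : ∀ {p q} → p * S ≤ q → p ≤ q * r
        multiply {p} {q} pS≤q = ℚ.≤-trans (ℚ.≤-reflexive (sym
          (trans (ℚ.*-assoc p S r) (trans (cong (p *_) Sr≡1) (ℚ.*-identityʳ p))))) (*-monoˡ 0≤r pS≤q)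

        r≤a : r ≤ a
        r≤a = subst (_≤ a) (ℚ.*-identityˡ r) (divide (begin
          1ℚ                                ≡⟨ ^-inverse m [1-t][1+s]≡1 ⟨
          a * (1ℚ + s) ^ m                  ≤⟨ *-monoʳ (0≤^ m 0≤1-t) ([1+s]^n≤expSum 0≤s m) ⟩
          a * expSum n (κ m * s)            ≡⟨ cong (λ y → a * expSum n y) ms≡1 ⟩
          a * expSum n 1ℚ                   ≤⟨ *-monoʳ (0≤^ m 0≤1-t) (expSum-mono 0≤1 (ℕ.≤⇒≤′ n≤k)) ⟩
          a * expSum k 1ℚ                   ≡⟨ cong (a *_) (expSum-1 k) ⟩
          a * S                             ∎))
          where open ℚ.≤-Reasoning

        [1-t]a≤r : (1ℚ - t) * a ≤ r
        [1-t]a≤r = subst ((1ℚ - t) * a ≤_) (ℚ.*-identityˡ r) (multiply (begin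
          (1ℚ - t) ^ n * S                    ≡⟨ cong ((1ℚ - t) ^ n *_) (expSum-1 k) ⟨
          (1ℚ - t) ^ n * expSum k 1ℚ          ≤⟨ *-monoʳ (0≤^ n 0≤1-t) (expSum-suc k 0≤1) ⟩
          (1ℚ - t) ^ n * expSum (suc k) 1ℚ    ≡⟨ cong (λ y → (1ℚ - t) ^ n * expSum (suc k) y) nt≡1 ⟨
          (1ℚ - t) ^ n * expSum (suc k) (κ n * t) ≤⟨ [1-t]^n*expSum≤1 0≤t t≤1 k n ⟩
          1ℚ                                  ∎))
          where open ℚ.≤-Reasoning

      -- Both numbers lie between (1 - t) a and a, an interval of length t a ≤ t.
      reciprocal-e-close : ∣ (1ℚ - t) ^ m - r ∣ ≤ t
      reciprocal-e-close = begin
        ∣ a - r ∣             ≡⟨ ℚ.0≤p⇒∣p∣≡p (subst (_≤ a - r) (ℚ.+-inverseʳ r) (ℚ.+-monoˡ-≤ (- r) r≤a)) ⟩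
        a - r                 ≤⟨ ℚ.+-monoʳ-≤ a (ℚ.neg-antimono-≤ [1-t]a≤r) ⟩
        a - (1ℚ - t) * a      ≡⟨ solve 2 (λ a t → a :- (con 1ℚ :- t) :* a := a :* t) refl a t ⟩
        a * t                 ≤⟨ *-monoˡ 0≤t (a≤1 m) ⟩
        1ℚ * t                ≡⟨ ℚ.*-identityˡ t ⟩
        t                     ∎
        where open ℚ.≤-Reasoning

    -- As 1 - t = m/n, the hypothesis is T/D = (m/n)ᵐ with denominators cleared.
    power-ratio : ∀ T D .{{_ : NonZero D}} → T ℕ.* n ℕ.^ m ≡ m ℕ.^ m ℕ.* D → + T / D ≡ (1ℚ - t) ^ m
    power-ratio T D eq = κ-cancel D (begin
      (+ T / D) * κ D                      ≡⟨ /-*-κ T D ⟩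
      κ T                                  ≡⟨ ℚ.*-identityʳ (κ T) ⟨
      κ T * 1ℚ                             ≡⟨ cong (κ T *_) (^-inverse m nt≡1) ⟨
      κ T * (κ n ^ m * t ^ m)              ≡⟨ ℚ.*-assoc (κ T) (κ n ^ m) (t ^ m) ⟨
      κ T * κ n ^ m * t ^ m                ≡⟨ cong (_* t ^ m) (trans (cong (κ T *_) (sym (κ-^ n m))) (sym (κ-* T (n ℕ.^ m)))) ⟩
      κ (T ℕ.* n ℕ.^ m) * t ^ m            ≡⟨ cong (λ k → κ k * t ^ m) eq ⟩
      κ (m ℕ.^ m ℕ.* D) * t ^ m            ≡⟨ cong (_* t ^ m) (trans (κ-* (m ℕ.^ m) D) (cong (_* κ D) (κ-^ m m))) ⟩
      κ m ^ m * κ D * t ^ m                ≡⟨ solve 3 (λ a d b → a :* d :* b := a :* b :* d) refl (κ m ^ m) (κ D) (t ^ m) ⟩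
      κ m ^ m * t ^ m * κ D                ≡⟨ cong (_* κ D) (^-distrib-* (κ m) t m) ⟨
      (κ m * t) ^ m * κ D                  ≡⟨ cong (λ q → q ^ m * κ D) 1-t≡mt ⟨
      (1ℚ - t) ^ m * κ D                   ∎)
      where open ≡-Reasoning

  archimedean : ∀ {η} → 0ℚ < η → ∃[ N ] ∀ {n} → N ℕ.≤ n → .{{_ : NonZero n}} → + 1 / n ≤ η
  archimedean {η@(ℚ.mkℚ (+ 0) _ _)} (ℚ.*<* (ℤ.+<+ ()))
  archimedean {η@(ℚ.mkℚ ℤ.-[1+ _ ] _ _)} (ℚ.*<* ())
  -- Here η = (k + 1)/(d + 1) ≥ 1/(d + 1), so the denominator serves as N.
  archimedean {η@(ℚ.mkℚ (+ suc k) d _)} 0<η = suc d , λ {n} N≤n → begin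
    + 1 / n                          ≡⟨ ℚ.*-identityˡ (+ 1 / n) ⟨
    1ℚ * (+ 1 / n)                   ≤⟨ *-monoˡ (0≤1/ n) (ℚ.≤-trans (κ-mono {1} {suc k} (s≤s z≤n)) (ℚ.≤-reflexive (sym ηκ≡))) ⟩
    η * κ (suc d) * (+ 1 / n)        ≤⟨ *-monoˡ (0≤1/ n) (*-monoʳ (ℚ.<⇒≤ 0<η) (κ-mono N≤n)) ⟩
    η * κ n * (+ 1 / n)              ≡⟨ solve 3 (λ e k i → e :* k :* i := e :* (i :* k)) refl η (κ n) (+ 1 / n) ⟩
    η * ((+ 1 / n) * κ n)            ≡⟨ cong (η *_) (/-*-κ 1 n) ⟩
    η * 1ℚ                           ≡⟨ ℚ.*-identityʳ η ⟩
    η                                ∎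
    where
    open ℚ.≤-Reasoning
    ηκ≡ : η * κ (suc d) ≡ κ (suc k)
    ηκ≡ = trans (cong (_* κ (suc d)) (sym (ℚ.↥p/↧p≡p η))) (/-*-κ (suc k) (suc d))

  0<½* : ∀ {δ} → 0ℚ < δ → 0ℚ < δ * ½
  0<½* {δ} 0<δ = ℚ.positive⁻¹ (δ * ½) {{ℚ.pos*pos⇒pos δ {{ℚ.positive 0<δ}} ½}}

  -- ε eventually exceeds some rational δ > 0. Half of δ bounds 1/(m + 1) for large p, the other
  -- half is the margin that `_<ℝ_` demands. The index from which the sequences are compared may
  -- depend on p.
  limit-1/e : ∀ {a : ∀ p → Prime p → ℚ} {m : ∀ p → Prime p → ℕ} →
    (∀ p pr → NonZero (m p pr)) → (∀ p pr → p ℕ.≤ suc (m p pr)) →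
    (∀ p pr → a p pr ≡ (1ℚ - + 1 / suc (m p pr)) ^ m p pr) →
    LimitOverPrimes (λ p pr → fromℚ (a p pr)) (reciprocal e 0<e)
  limit-1/e {a} {m} m≢0 p≤ a≡ ε (δ , 0<δ , K , δ≤ε) with N , 1/n≤ ← archimedean (0<½* 0<δ) =
    N , λ p pr N≤p → δ * ½ , 0<½* 0<δ , suc (m p pr) ℕ.⊔ K , λ k l → begin
      ∣ a p pr - Reciprocal.recip 1ℚ 0<1 (expPartialSum k) ∣ + δ * ½
        ≡⟨ cong (λ b → ∣ b - Reciprocal.recip 1ℚ 0<1 (expPartialSum k) ∣ + δ * ½) (a≡ p pr) ⟩
      ∣ (1ℚ - + 1 / suc (m p pr)) ^ m p pr - Reciprocal.recip 1ℚ 0<1 (expPartialSum k) ∣ + δ * ½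
        ≤⟨ ℚ.+-monoˡ-≤ (δ * ½) (reciprocal-e-close (m p pr) {{m≢0 p pr}} (ℕ.m⊔n≤o⇒m≤o (suc (m p pr)) K l)) ⟩
      + 1 / suc (m p pr) + δ * ½
        ≤⟨ ℚ.+-monoˡ-≤ (δ * ½) (1/n≤ (ℕ.≤-trans N≤p (p≤ p pr))) ⟩
      δ * ½ + δ * ½
        ≡⟨ solve 1 (λ d → d :* con ½ :+ d :* con ½ := con 0ℚ :+ d) refl δ ⟩
      0ℚ + δ
        ≤⟨ δ≤ε k (ℕ.m⊔n≤o⇒n≤o (suc (m p pr)) K l) ⟩
      seq ε k ∎
    where
    open ℚ.≤-Reasoning

-- The cardinality of T

open ℕ-Solver using () renaming (solve to ℕ-solve; _:*_ to _:*ℕ_; _:=_ to _:=ℕ_)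

-- The crude p² ≤ pᵖ suffices. With q = M + 1 it shows both that M is positive and that 1/(M + 1)
-- tends to 0.
p^p≡q*p⇒p≤q : ∀ {p q} → 2 ℕ.≤ p → p ℕ.^ p ≡ q ℕ.* p → p ℕ.≤ q
p^p≡q*p⇒p≤q {p@(suc _)} {q} 2≤p p^p≡q*p = ℕ.*-cancelʳ-≤ p q p (begin
  p ℕ.* p      ≡⟨ ≡.cong (p ℕ.*_) (ℕ.*-identityʳ p) ⟨
  p ℕ.^ 2      ≤⟨ ℕ.^-monoʳ-≤ p 2≤p ⟩
  p ℕ.^ p      ≡⟨ p^p≡q*p ⟩
  q ℕ.* p      ∎)
  where open ℕ.≤-Reasoning

^-distribʳ-* : ∀ k a b → (a ℕ.* b) ℕ.^ k ≡ a ℕ.^ k ℕ.* b ℕ.^ k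
^-distribʳ-* zero a b = ≡.refl
^-distribʳ-* (suc k) a b = ≡.trans (≡.cong (a ℕ.* b ℕ.*_) (^-distribʳ-* k a b))
  (ℕ.[m*n]*[o*p]≡[m*o]*[n*p] a b (a ℕ.^ k) (b ℕ.^ k))

-- Put q = pᵖ = (m + 1) p. Then (m + 1)ᵐ pᵐ = qᵐ, and q · qᵐ = p^(p (m + 1)) = p^q. The result is
-- the hypothesis of `power-ratio` for the count of T.
power-ratio-identity : ∀ {p} m → p ℕ.^ p ≡ suc m ℕ.* p →
  p ℕ.^ p ℕ.* (m ℕ.* p) ℕ.^ m ℕ.* suc m ℕ.^ m ≡ m ℕ.^ m ℕ.* p ℕ.^ (p ℕ.^ p)
power-ratio-identity {p} m p^p≡ = begin
  q ℕ.* (m ℕ.* p) ℕ.^ m ℕ.* suc m ℕ.^ m              ≡⟨ ≡.cong (λ k → q ℕ.* k ℕ.* suc m ℕ.^ m) (^-distribʳ-* m m p) ⟩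
  q ℕ.* (m ℕ.^ m ℕ.* p ℕ.^ m) ℕ.* suc m ℕ.^ m        ≡⟨ ℕ-solve 4 (λ q a b c → q :*ℕ (a :*ℕ b) :*ℕ c :=ℕ a :*ℕ (q :*ℕ (c :*ℕ b))) ≡.refl q (m ℕ.^ m) (p ℕ.^ m) (suc m ℕ.^ m) ⟩
  m ℕ.^ m ℕ.* (q ℕ.* (suc m ℕ.^ m ℕ.* p ℕ.^ m))      ≡⟨ ≡.cong (λ k → m ℕ.^ m ℕ.* (q ℕ.* k)) (^-distribʳ-* m (suc m) p) ⟨
  m ℕ.^ m ℕ.* (q ℕ.* (suc m ℕ.* p) ℕ.^ m)            ≡⟨ ≡.cong (λ k → m ℕ.^ m ℕ.* (q ℕ.* k ℕ.^ m)) p^p≡ ⟨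
  m ℕ.^ m ℕ.* (q ℕ.* q ℕ.^ m)                        ≡⟨ ≡.cong (λ k → m ℕ.^ m ℕ.* (q ℕ.* k)) (≡.trans (ℕ.^-*-assoc p p m) (≡.cong (p ℕ.^_) (ℕ.*-comm p m))) ⟩
  m ℕ.^ m ℕ.* (q ℕ.* p ℕ.^ (m ℕ.* p))                ≡⟨ ≡.cong (m ℕ.^ m ℕ.*_) (ℕ.^-distribˡ-+-* p p (m ℕ.* p)) ⟨
  m ℕ.^ m ℕ.* p ℕ.^ (suc m ℕ.* p)                    ≡⟨ ≡.cong (λ k → m ℕ.^ m ℕ.* p ℕ.^ k) p^p≡ ⟨
  m ℕ.^ m ℕ.* p ℕ.^ q                                ∎
  where
  open ≡.≡-Reasoning
  q = p ℕ.^ p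

module Count {c ℓ p} (pr : Prime p) (F : FiniteField c ℓ (p ℕ.^ p)) where

  open Frobenius pr F
  open FreeOrbits using (iterate; module Orbits)

  Φ : Fin (p ℕ.^ p) → Fin (p ℕ.^ p)
  Φ = index ∘ φ ∘ elem

  -- Iterating φ k times raises to the power pᵏ; k = p turns x^(pᵖ) = x into Φᵖ = id.
  iterate-Φ : ∀ k i → iterate Φ k i ≡ index (elem i ^ (p ℕ.^ k))
  iterate-Φ zero    i = ≡.trans (≡.sym (index-elem i)) (Enum.to-cong (sym (*-identityʳ (elem i))))
  iterate-Φ (suc k) i = Enum.to-cong (begin
    φ (elem (iterate Φ k i))               ≡⟨ ≡.cong (φ ∘ elem) (iterate-Φ k i) ⟩
    φ (elem (index (elem i ^ (p ℕ.^ k))))  ≈⟨ φ-cong (elem-index _) ⟩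
    (elem i ^ (p ℕ.^ k)) ^ p               ≈⟨ ^-assocʳ (elem i) (p ℕ.^ k) p ⟩
    elem i ^ (p ℕ.^ k ℕ.* p)               ≈⟨ ^-congʳ (elem i) (ℕ.*-comm (p ℕ.^ k) p) ⟩
    elem i ^ (p ℕ.^ suc k)                 ∎)

  Φᵖ≗id : ∀ i → iterate Φ p i ≡ i
  Φᵖ≗id i = ≡.trans (iterate-Φ p i) (≡.trans (Enum.to-cong (x^order≈x (elem i))) (index-elem i))

  private
    module O = Orbits pr Φ Φᵖ≗id

  fixed⁺ : ∀ {x} → Fixed x → O.Fixed (index x)
  fixed⁺ fx = Enum.to-cong (trans (φ-cong (elem-index _)) fx)

  fixed⁻ : ∀ {i} → O.Fixed i → Fixed (elem i)
  fixed⁻ eq = trans (sym (elem-index _)) (reflexive (≡.cong elem eq))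

  ι-onto : ∀ {i} → O.Fixed i → ∃[ k ] index (ι k) ≡ i
  ι-onto eq with k , x≈ι ← fixed⇒ι (fixed⁻ eq) = k , ≡.trans (Enum.to-cong (sym x≈ι)) (index-elem _)

  private
    module Maps = O.Maps (index ∘ ι) (fixed⁺ ∘ ι-fixed) (ι-injective ∘ index-injective) ι-onto
  open O public using (M)
  open Maps public using (count)
  open Maps using (decode; decode-injective; extend-equivariant; extend-preserving; fixedPart; freePart)

  p^p≡[1+M]p : p ℕ.^ p ≡ suc M ℕ.* p
  p^p≡[1+M]p = Maps.N≡Q+Mp

  module _ (f : Map F) where

    conjugate : Fin (p ℕ.^ p) → Fin (p ℕ.^ p)
    conjugate i = index (f ⟨$⟩ elem i)

    conjugate-equivariant : Equivariant (f ⟨$⟩_) → ∀ i → conjugate (Φ i) ≡ Φ (conjugate i)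
    conjugate-equivariant equivariant i = Enum.to-cong (begin
      f ⟨$⟩ elem (Φ i)                 ≈⟨ Func.cong f (elem-index _) ⟩
      f ⟨$⟩ φ (elem i)                 ≈⟨ equivariant (elem i) ⟩
      φ (f ⟨$⟩ elem i)                 ≈⟨ φ-cong (elem-index _) ⟨
      φ (elem (conjugate i))           ∎)

    conjugate-preserving : Preserving (f ⟨$⟩_) → ∀ i → ¬ O.Fixed i → ¬ O.Fixed (conjugate i)
    conjugate-preserving preserving i ¬fi fgi = preserving (elem i)
      (λ fx → ¬fi (≡.subst O.Fixed (index-elem i) (fixed⁺ fx)))
      (trans (φ-cong (sym (elem-index _))) (trans (fixed⁻ fgi) (elem-index _)))

  mapOf : Fin count → Map F
  mapOf k = record
    { to   = λ x → elem (decode k (index x))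
    ; cong = λ x≈y → reflexive (≡.cong (elem ∘ decode k) (Enum.to-cong x≈y))
    }

  mapOf-equivariant : ∀ k → Equivariant (mapOf k ⟨$⟩_)
  mapOf-equivariant k x = begin
    elem (decode k (index (φ x)))                ≡⟨ ≡.cong (elem ∘ decode k) (Enum.to-cong (φ-cong (elem-index x))) ⟨
    elem (decode k (Φ (index x)))                ≡⟨ ≡.cong elem (extend-equivariant (fixedPart k) (freePart k) (index x)) ⟩
    elem (Φ (decode k (index x)))                ≈⟨ elem-index _ ⟩
    φ (elem (decode k (index x)))                ∎

  mapOf-preserving : ∀ k → Preserving (mapOf k ⟨$⟩_)
  mapOf-preserving k x ¬fx fy = extend-preserving (fixedPart k) (freePart k) (index x)
    (λ fi → ¬fx (trans (φ-cong (sym (elem-index x))) (trans (fixed⁻ fi) (elem-index x))))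
    (≡.subst O.Fixed (index-elem _) (fixed⁺ fy))

  -- `to` also takes the proofs carried by an element of T, so its congruence is not immediate. It
  -- follows from `decode-injective`, since decoding the code returns the underlying map alone.
  T-cardinality : HasCardinality (T p p F) count
  T-cardinality = record
    { to        = to
    ; from      = from
    ; to-cong   = λ {t} {t′} eq → decode-injective λ i →
        ≡.trans (decode-to t i) (≡.trans (Enum.to-cong (eq (elem i))) (≡.sym (decode-to t′ i)))
    ; from-cong = λ { ≡.refl x → refl }
    ; inverse   = (λ {k} {t} eq → decode-injective λ i →
                    ≡.trans (decode-to t i) (≡.trans (Enum.to-cong (eq (elem i)))
                      (≡.trans (index-elem _) (≡.cong (decode k) (index-elem i)))))
                , (λ { {t} ≡.refl x → begin
                    elem (decode (to t) (index x))         ≡⟨ ≡.cong elem (decode-to t (index x)) ⟩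
                    elem (conjugate (proj₁ t) (index x))   ≈⟨ elem-index _ ⟩
                    proj₁ t ⟨$⟩ elem (index x)             ≈⟨ Func.cong (proj₁ t) (elem-index x) ⟩
                    proj₁ t ⟨$⟩ x                          ∎ })
    }
    where
    module E ((f , sp , cb) : Σ[ f ∈ Map F ] SubfieldPreserving p p F f × CoefficientsInBase p p F f) =
      Maps.Encode (conjugate-equivariant f (coefficientsInBase⇒equivariant {f} cb))
                  (conjugate-preserving f (subfieldPreserving⇒preserving {f} sp))
    to = E.encode
    from : Fin count → _
    from k = mapOf k , equivariant∧preserving⇒subfieldPreserving {mapOf k} (mapOf-equivariant k) (mapOf-preserving k)
                     , equivariant⇒coefficientsInBase {mapOf k} (mapOf-equivariant k)
    decode-to : ∀ t i → decode (to t) i ≡ conjugate (proj₁ t) i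
    decode-to = E.decode-encode

  p≤1+M : p ℕ.≤ suc M
  p≤1+M = p^p≡q*p⇒p≤q (ℕ.nonTrivial⇒n>1 p {{prime⇒nonTrivial pr}}) p^p≡[1+M]p

  M≢0 : NonZero M
  M≢0 = ℕ.>-nonZero (ℕ.s≤s⁻¹ (ℕ.≤-trans (ℕ.nonTrivial⇒n>1 p {{prime⇒nonTrivial pr}}) p≤1+M))

  count-ratio : count ℕ.* suc M ℕ.^ M ≡ M ℕ.^ M ℕ.* p ℕ.^ (p ℕ.^ p)
  count-ratio = power-ratio-identity M p^p≡[1+M]p

open import Data.Integer.Base using (+_)
open import Data.Nat.Base using (_^_)
open import Data.Nat.Properties using (m^n≢0)
open import Data.Rational.Base using (_/_)

corollary22 : ∀ {c ℓ} (F : ∀ p → Prime p → FiniteField c ℓ (p ^ p)) →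
    Σ[ ∣T∣ ∈ (∀ p → Prime p → ℕ) ]
    (∀ p (pr : Prime p) → HasCardinality (T p p (F p pr)) (∣T∣ p pr)) ×
    LimitOverPrimes
    (λ p pr → fromℚ (_/_ (+ ∣T∣ p pr) (p ^ (p ^ p)) {{m^n≢0 p (p ^ p) {{prime⇒nonZero pr}}}}))
    (reciprocal e 0<e)
corollary22 F =
  (λ p pr → count pr (F p pr)) ,
  (λ p pr → T-cardinality pr (F p pr)) ,
  limit-1/e (λ p pr → M≢0 pr (F p pr)) (λ p pr → p≤1+M pr (F p pr))
    (λ p pr → power-ratio (M pr (F p pr)) {{M≢0 pr (F p pr)}} (count pr (F p pr)) (p ^ (p ^ p))
                {{m^n≢0 p (p ^ p) {{prime⇒nonZero pr}}}} (count-ratio pr (F p pr)))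
  where
  open Count
  open ExponentialBounds
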